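{- Let $\mu>1$ and $\beta=\beta(\mu)>0$. Suppose there is a finite subfamily $\mathcal{I}'_\mu\subseteq\mathcal{I}_\mu$ that is $\beta$-hard for every randomized algorithm using zero migrations, i.e., for every randomized online algorithm $\mathcal{A}_R$ that makes no migrations there is $I\in\mathcal{I}'_\mu$ with $\mathbb{E}_R\,\mathrm{cost}(\mathcal{A}_R,I)\ge\beta\,\mathrm{OPT}(I)$. Let $\mathcal{A}_R$ be any randomized online algorithm whose expected number of migrations is sublinear on $\mathcal{I}_\mu$, i.e., $\max_{I\in\mathcal{I}_\mu,\,|I|=n}\mathbb{E}_R\,\mathrm{mig}(\mathcal{A}_R,I)\in o(n)$. Then there is an instance $I\in\mathcal{I}_\mu$ with $\mathbb{E}_R\,\mathrm{cost}(\mathcal{A}_R,I)\ge\frac{\beta}{3}\,\mathrm{OPT}(I)$.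
   Context: Dynamic bin packing: bins have capacity $1$; items arrive online at times $a_i\ge 0$ with size $s_i\in[0,1]$ and duration $d_i>0$, present during $[a_i,a_i+d_i)$; at arrival only the size is revealed (non-clairvoyant). Each arriving item is placed in an open bin with enough remaining capacity or in a new bin; a migration moves an already placed item to another bin. $\mathcal{I}_\mu$ is the family of all instances all of whose item durations lie in $[1,\mu]$; $|I|$ is the number of items of $I$. $\mathrm{cost}(\mathcal{A},I)$ is the total active time $\int_0^\infty(\text{number of nonempty bins at } t)\,dt$ of algorithm $\mathcal{A}$ on $I$, $\mathrm{mig}(\mathcal{A},I)$ its number of migrations, and $\mathbb{E}_R$ the expectation over the algorithm's internal randomness. $\mathrm{OPT}(I)=\int_0^\infty\mathrm{OPT}_t\,dt$, where $\mathrm{OPT}_t$ is the minimum number of unit bins needed to pack the items present at time $t$. -}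

module Defs where

open import Algebra.Structures using (IsCommutativeRing)
open import Data.Bool.Base using (if_then_else_)
open import Data.List.Base using (List; []; _∷_; _++_; [_]; map; foldr; length; filter; deduplicate; concatMap; zipWith; upTo)
open import Data.List.Extrema.Nat using (min)
open import Data.List.Relation.Binary.Pointwise.Base using (Pointwise)
open import Data.List.Relation.Unary.All using (All; all?)
open import Data.List.Relation.Unary.AllPairs using (AllPairs)
open import Data.List.Relation.Unary.Linked using (Linked)
open import Data.Nat.Base as ℕ using (ℕ; zero; suc)
import Data.Nat.ListAction as ℕ
import Data.Nat.Properties as ℕ
open import Data.Product.Base using (∃; ∃-syntax; _×_; _,_; proj₁; proj₂)
open import Data.Unit.Base using (⊤)
open import Function.Base using (_∘_)
open import Function.Bundles using (_⇔_)
open import Relation.Binary.Bundles using (DecTotalOrder)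
open import Relation.Binary.Definitions using (Decidable)
open import Relation.Binary.PropositionalEquality.Core using (_≡_; _≢_)
open import Relation.Binary.Structures using (IsDecTotalOrder)
open import Relation.Nullary.Decidable.Core using (does; ¬?; _×-dec_)
open import Relation.Nullary.Negation.Core using (¬_)
import Data.List.Sort.InsertionSort.Base as InsertionSort
import Relation.Binary.Construct.NonStrictToStrict as Strict
import Relation.Binary.Construct.On as On

-- The real numbers, axiomatised (classically) as a Dedekind-complete ordered
-- field; this determines them up to isomorphism.  The value of 0ℝ ⁻¹ is left
-- unspecified.
record Reals : Set₁ where
  infixl 6 _+_ _-_
  infixl 7 _*_ _/_
  infix  8 -_ _⁻¹
  infix  4 _≤_
  field
    ℝ    : Set
    _+_  : ℝ → ℝ → ℝ
    _*_  : ℝ → ℝ → ℝ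
    -_   : ℝ → ℝ
    _⁻¹  : ℝ → ℝ
    0ℝ   : ℝ
    1ℝ   : ℝ
    _≤_  : ℝ → ℝ → Set
    isCommutativeRing : IsCommutativeRing _≡_ _+_ _*_ -_ 0ℝ 1ℝ
    0≢1               : 0ℝ ≢ 1ℝ
    *-inverseʳ        : ∀ x → x ≢ 0ℝ → x * x ⁻¹ ≡ 1ℝ
    isDecTotalOrder   : IsDecTotalOrder _≡_ _≤_
    +-monoʳ-≤         : ∀ x {y z} → y ≤ z → x + y ≤ x + z
    *-nonNeg          : ∀ {x y} → 0ℝ ≤ x → 0ℝ ≤ y → 0ℝ ≤ x * y

  IsUpperBound : (ℝ → Set) → ℝ → Set
  IsUpperBound S u = ∀ x → S x → x ≤ u

  IsLeastUpperBound : (ℝ → Set) → ℝ → Set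
  IsLeastUpperBound S s = IsUpperBound S s × (∀ u → IsUpperBound S u → s ≤ u)

  field
    complete : (S : ℝ → Set) → ∃ S → ∃ (IsUpperBound S) → ∃ (IsLeastUpperBound S)

  open Strict _≡_ _≤_ public using (_<_)
  open IsDecTotalOrder isDecTotalOrder public using (_≟_; _≤?_)

  _<?_ : Decidable _<_
  _<?_ = Strict.<-decidable _≡_ _≤_ _≟_ _≤?_

  decTotalOrder : DecTotalOrder _ _ _
  decTotalOrder = record { isDecTotalOrder = isDecTotalOrder }

  _-_ : ℝ → ℝ → ℝ
  x - y = x + (- y)

  _/_ : ℝ → ℝ → ℝ
  x / y = x * y ⁻¹

  fromℕ : ℕ → ℝ
  fromℕ zero    = 0ℝ
  fromℕ (suc n) = 1ℝ + fromℕ n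

  sum : List ℝ → ℝ
  sum = foldr _+_ 0ℝ

module Probability (R : Reals) where
  open Reals R

  record ProbabilitySpace : Set₁ where
    field
      Ω          : Set
      Measurable : (Ω → Set) → Set
      ℙ          : (A : Ω → Set) → Measurable A → ℝ

      -- Events are extensional: they matter only up to logical equivalence.
      measurable-resp : ∀ {A B} → (∀ ω → A ω ⇔ B ω) → Measurable A → Measurable B
      ℙ-resp          : ∀ {A B} (a : Measurable A) (b : Measurable B) →
                        (∀ ω → A ω ⇔ B ω) → ℙ A a ≡ ℙ B b

      measurable-whole : Measurable (λ _ → ⊤)
      measurable-∁     : ∀ {A} → Measurable A → Measurable (λ ω → ¬ A ω)
      measurable-⋃     : ∀ {A : ℕ → Ω → Set} → (∀ n → Measurable (A n)) →
                         Measurable (λ ω → ∃[ n ] A n ω)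

      ℙ-nonNeg : ∀ {A} (a : Measurable A) → 0ℝ ≤ ℙ A a
      ℙ-whole  : ℙ (λ _ → ⊤) measurable-whole ≡ 1ℝ

      -- The sum of a series of non-negative terms is the least upper bound of
      -- its partial sums.
      ℙ-⋃      : ∀ {A : ℕ → Ω → Set} (a : ∀ n → Measurable (A n)) →
                 (∀ m n → m ≢ n → ∀ ω → A m ω → ¬ A n ω) →
                 IsLeastUpperBound
                   (λ x → ∃[ n ] x ≡ sum (map (λ k → ℙ (A k) (a k)) (upTo n)))
                   (ℙ (λ ω → ∃[ n ] A n ω) (measurable-⋃ a))

    -- A non-negative simple function Σᵢ vᵢ·1_{Aᵢ} with the Aᵢ pairwise disjoint
    -- (so that it vanishes off their union).
    record Piece : Set₁ where
      field
        value      : ℝ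
        value≥0    : 0ℝ ≤ value
        event      : Ω → Set
        measurable : Measurable event
    open Piece public

    record Simple : Set₁ where
      field
        pieces   : List Piece
        disjoint : AllPairs (λ p q → ∀ ω → event p ω → ¬ event q ω) pieces
    open Simple public

    -- Y is pointwise below the non-negative function X.
    Below : Simple → (Ω → ℝ) → Set₁
    Below Y X = All (λ p → ∀ ω → event p ω → value p ≤ X ω) (pieces Y)

    𝔼-simple : Simple → ℝ
    𝔼-simple Y = sum (map (λ p → value p * ℙ (event p) (measurable p)) (pieces Y))

    -- For X ≥ 0, the Lebesgue integral 𝔼 X ∈ [0,∞] is the supremum of 𝔼 Y over
    -- the simple functions 0 ≤ Y ≤ X.  As it may be infinite, 𝔼 X is not given
    -- as a real number, but by its comparisons with real numbers.
    𝔼[_]≤_ : (Ω → ℝ) → ℝ → Set₁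
    𝔼[ X ]≤ c = ∀ Y → Below Y X → 𝔼-simple Y ≤ c

    𝔼[_]≥_ : (Ω → ℝ) → ℝ → Set₁
    𝔼[ X ]≥ c = ∀ u → 𝔼[ X ]≤ u → c ≤ u

module DynamicBinPacking (R : Reals) where
  open Reals R public
  open Probability R

  record Item : Set where
    field
      arrival    : ℝ
      size       : ℝ
      duration   : ℝ
      arrival≥0  : 0ℝ ≤ arrival
      size≥0     : 0ℝ ≤ size
      size≤1     : size ≤ 1ℝ
      duration>0 : 0ℝ < duration

    departure : ℝ
    departure = arrival + duration
  open Item public

  -- Items are listed in their order of arrival; items arriving at the same time
  -- are revealed one by one, in list order.  The empty instance is excluded: on
  -- it every algorithm has cost 0 = OPT, so that any bound cost ≥ β·OPT would
  -- hold trivially.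
  record Instance : Set where
    field
      items    : List Item
      nonEmpty : items ≢ []
      sorted   : Linked (λ i j → arrival i ≤ arrival j) items
  open Instance public

  ∣_∣ : Instance → ℕ
  ∣ I ∣ = length (items I)

  𝓘 : ℝ → Instance → Set
  𝓘 μ I = All (λ i → 1ℝ ≤ duration i × duration i ≤ μ) (items I)

  -- Items are identified by their position in the order of arrival.
  ItemId = ℕ
  Bin    = ℕ

  data Action : Set where
    arrive : ItemId → (size : ℝ) → Action
    depart : ItemId → Action

  record Event : Set where
    constructor _at_
    field
      action : Action
      time   : ℝ
  open Event public

  -- The sort is stable and items are present on half-open intervals, so
  -- departures are put before arrivals to have them come first at equal times.
  events : Instance → List Event
  events I = InsertionSort.sort (On.decTotalOrder decTotalOrder time) (departures ++ arrivals)
    where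
    ids        = upTo ∣ I ∣
    departures = zipWith (λ n i → depart n at departure i) ids (items I)
    arrivals   = zipWith (λ n i → arrive n (size i) at arrival i) ids (items I)

  -- All that a non-clairvoyant algorithm has observed up to and including the
  -- current event, in chronological order.
  History = List Event

  record Placed : Set where
    constructor placed
    field
      id     : ItemId
      weight : ℝ
      bin    : Bin
  open Placed public

  -- The items present, with their bins.
  Config = List Placed

  load : Bin → Config → ℝ
  load b c = sum (map weight (filter (λ p → bin p ℕ.≟ b) c))

  Feasible : Config → Set
  Feasible c = ∀ b → load b c ≤ 1ℝ

  nonemptyBins : Config → ℕ
  nonemptyBins c = length (deduplicate ℕ._≟_ (map bin c))

  -- A simultaneous repacking: each listed item goes to the given bin, all others
  -- stay.  If an item is listed repeatedly, its first entry counts.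
  Repacking = List (ItemId × Bin)

  target : Repacking → Placed → Bin
  target []             p = bin p
  target ((n , b) ∷ ms) p = if does (n ℕ.≟ id p) then b else target ms p

  repack : Repacking → Config → Config
  repack ms = map (λ p → record p { bin = target ms p })

  -- The number of items that change their bin.
  migrations : Repacking → Config → ℕ
  migrations ms c = length (filter (λ p → ¬? (target ms p ℕ.≟ bin p)) c)

  -- The decisions of an online algorithm with its randomness fixed.  On an event
  -- it immediately carries out the repacking `migrate` and, if the event is an
  -- arrival, puts the new item into the bin `place`.  As it learns nothing new
  -- until the next event, whatever it does in the meantime is determined by now:
  -- `later` lists repackings with their delays after the present event, of which
  -- those due strictly before the next event are carried out and the others are
  -- dropped.
  record Policy : Set where
    field
      place        : History → Bin
      migrate      : History → Repacking
      later        : History → List (ℝ × Repacking)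
      later-sorted : ∀ h → Linked _≤_ (0ℝ ∷ map proj₁ (later h))
  open Policy public

  -- A period during which the configuration is constant, with the number of
  -- migrations made at its beginning.
  record Period : Set where
    constructor period
    field
      moved   : ℕ
      config  : Config
      elapsed : ℝ
  open Period public

  -- The periods from `now` (both times counted from the present event) until
  -- the next event, with the final configuration.
  execute : (m : ℕ) (now next : ℝ) → Config → List (ℝ × Repacking) → List Period × Config
  execute m now next c []              = [ period m c (next - now) ] , c
  execute m now next c ((t , ms) ∷ ss) =
    if does (t <? next)
    then (let (ps , c′) = execute (migrations ms c) t next (repack ms c) ss
          in period m c (t - now) ∷ ps , c′)
    else [ period m c (next - now) ] , c

  remaining : Action → Config → Config
  remaining (arrive _ _) c = c
  remaining (depart n)   c = filter (λ p → ¬? (id p ℕ.≟ n)) c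

  incoming : Action → Bin → Config
  incoming (arrive n s) b = [ placed n s b ]
  incoming (depart _)   b = []

  -- The last event of an instance is a departure leaving all bins empty, so
  -- nothing needs to be recorded from then on.
  trace : Policy → History → Config → List Event → List Period
  trace A h c []                = []
  trace A h c (e ∷ [])          = []
  trace A h c (e ∷ es@(e′ ∷ _)) =
    let h₁        = h ++ [ e ]
        c₀        = remaining (action e) c
        ms        = migrate A h₁
        c₁        = repack ms c₀ ++ incoming (action e) (place A h₁)
        (ps , c₂) = execute (migrations ms c₀) 0ℝ (time e′ - time e) c₁ (later A h₁)
    in ps ++ trace A h₁ c₂ es

  run : Policy → Instance → List Period
  run A I = trace A [] [] (events I)

  cost : Policy → Instance → ℝ
  cost A I = sum (map (λ p → fromℕ (nonemptyBins (config p)) * elapsed p) (run A I))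

  mig : Policy → Instance → ℕ
  mig A I = ℕ.sum (map moved (run A I))

  -- All ways to distribute the entries of a list over nonempty bins.
  partitions : List ℝ → List (List (List ℝ))
  partitions []       = [ [] ]
  partitions (x ∷ xs) = concatMap (insertions x) (partitions xs)
    where
    insertions : ℝ → List (List ℝ) → List (List (List ℝ))
    insertions x []       = [ [ [ x ] ] ]
    insertions x (b ∷ bs) = ((x ∷ b) ∷ bs) ∷ map (b ∷_) (insertions x bs)

  -- The least number of unit bins for items of the given sizes.  As sizes are at
  -- most 1, the default (one bin per item) is itself feasible.
  minBins : List ℝ → ℕ
  minBins xs = min (length xs) (map length (filter (all? (λ b → sum b ≤? 1ℝ)) (partitions xs)))

  present : Instance → ℝ → List Item
  present I t = filter (λ i → (arrival i ≤? t) ×-dec (t <? departure i)) (items I)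

  OPT-at : Instance → ℝ → ℕ
  OPT-at I t = minBins (map size (present I t))

  -- ∫ f for a right-continuous step function f that is constant between
  -- consecutive entries of the sorted list and vanishes outside of its range.
  integrate : (ℝ → ℝ) → List ℝ → ℝ
  integrate f []                = 0ℝ
  integrate f (t ∷ [])          = 0ℝ
  integrate f (t ∷ ts@(t′ ∷ _)) = f t * (t′ - t) + integrate f ts

  OPT : Instance → ℝ
  OPT I = integrate (λ t → fromℕ (OPT-at I t)) (map time (events I))

  -- A randomised online algorithm: a random policy, all of whose decisions are
  -- random variables, that never overfills a bin.  Repackings and bins are
  -- discrete; the delays are a random element of the disjoint union of the ℝⁿ,
  -- whose Borel σ-algebra is generated by the orthants below.
  record RandomizedAlgorithm : Set₁ where
    field
      space : ProbabilitySpace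
    open ProbabilitySpace space public
    field
      policy             : Ω → Policy
      feasible           : ∀ ω I → All (Feasible ∘ config) (run (policy ω) I)
      place-measurable   : ∀ h b → Measurable (λ ω → place (policy ω) h ≡ b)
      migrate-measurable : ∀ h ms → Measurable (λ ω → migrate (policy ω) h ≡ ms)
      later-measurable   : ∀ h mss → Measurable (λ ω → map proj₂ (later (policy ω) h) ≡ mss)
      delay-measurable   : ∀ h ts → Measurable (λ ω → Pointwise _≤_ (map proj₁ (later (policy ω) h)) ts)

  𝔼cost[_,_]≥_ : RandomizedAlgorithm → Instance → ℝ → Set₁
  𝔼cost[ A , I ]≥ c = 𝔼[ (λ ω → cost (policy ω) I) ]≥ c
    where open RandomizedAlgorithm A

  𝔼mig[_,_]≤_ : RandomizedAlgorithm → Instance → ℝ → Set₁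
  𝔼mig[ A , I ]≤ c = 𝔼[ (λ ω → fromℕ (mig (policy ω) I)) ]≤ c
    where open RandomizedAlgorithm A

  MigrationFree : RandomizedAlgorithm → Set
  MigrationFree A = ∀ ω I → mig (policy ω) I ≡ 0
    where open RandomizedAlgorithm A

  -- max { 𝔼 mig(A,I) ∣ I ∈ 𝓘 μ, |I| = n } ∈ o(n)
  SublinearMigrations : ℝ → RandomizedAlgorithm → Set₁
  SublinearMigrations μ A =
    ∀ ε → 0ℝ < ε → ∃[ N ] (∀ n → N ℕ.≤ n → ∀ I → 𝓘 μ I → ∣ I ∣ ≡ n → 𝔼mig[ A , I ]≤ (ε * fromℕ n))

{-# OPTIONS --safe #-}
module Submission where

-- Run A on a long concatenation of instances from 𝓘′, separated in time.  The next instance is chosen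
-- against the migration-free algorithm that imitates A from the current history on: it puts each item
-- where A puts it if the item fits there, and into a fresh bin otherwise.  In a phase without migrations
-- A packs exactly like its imitation, so the phase costs A at least β·OPT in expectation, up to a constant
-- C times the probability of a migration.  These probabilities add up to at most the expected number of
-- migrations, which is sublinear in the number of phases, whereas OPT grows by at least 1 in each phase.

open import Algebra.Bundles using (CommutativeRing; RawRing)
import Algebra.Properties.Ring as RingProperties
import Algebra.Solver.Ring as RingSolver
open import Algebra.Solver.Ring.AlmostCommutativeRing using (fromCommutativeRing; _-Raw-AlmostCommutative⟶_)
open import Axiom.ExcludedMiddle using (ExcludedMiddle)
open import Data.Bool.Base using (if_then_else_)
open import Data.Empty using (⊥)
open import Data.List.Base using (List; []; _∷_; _++_; [_]; map; length; filter; deduplicate; zipWith; upTo; applyUpTo)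
import Data.List.Extrema.Nat as Extrema
open import Data.List.Membership.Propositional using (_∈_; find)
open import Data.List.Membership.Propositional.Properties using (∈-++⁺ˡ; ∈-++⁺ʳ; ∈-++⁻; ∈-map⁺; ∈-filter⁺)
import Data.List.Properties as List
import Data.List.Relation.Binary.Permutation.Propositional as Perm
open import Data.List.Relation.Binary.Permutation.Propositional.Properties using (∈-resp-↭; All-resp-↭)
open import Data.List.Relation.Binary.Pointwise.Base using (Pointwise; []; _∷_)
open import Data.List.Relation.Ternary.Interleaving.Propositional using (Interleaving; []; consˡ; consʳ)
import Data.List.Relation.Ternary.Interleaving.Properties as Interleaving⁺
import Data.List.Relation.Ternary.Interleaving.Propositional.Properties as Interleaving
open import Data.List.Relation.Unary.All as All using (All; []; _∷_; all?)
import Data.List.Relation.Unary.All.Properties as All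
open import Data.List.Relation.Unary.AllPairs as AllPairs using (AllPairs; []; _∷_)
import Data.List.Relation.Unary.AllPairs.Properties as AllPairs
open import Data.List.Relation.Unary.Any using (Any; here; there)
open import Data.List.Relation.Unary.Linked using (Linked; []; [-]; _∷_)
open import Data.List.Relation.Unary.Linked.Properties using (Linked⇒AllPairs; AllPairs⇒Linked)
import Data.List.Sort.InsertionSort.Base as InsertionSort
import Data.List.Sort.InsertionSort.Properties as Sorting
open import Data.Maybe.Base using (Maybe; just; nothing)
open import Data.Nat.Base as ℕ using (ℕ; zero; suc; z≤n; s≤s)
import Data.Nat.ListAction as ℕ
import Data.Nat.ListAction.Properties as ℕ
import Data.Nat.Properties as ℕ
open import Data.Product.Base using (Σ; ∃; ∃-syntax; ∃₂; _×_; _,_; proj₁; proj₂)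
open import Data.Sum.Base using (_⊎_; inj₁; inj₂; [_,_]′)
open import Data.Unit.Base using (⊤; tt)
open import Data.Vec.Base using (Vec; []; _∷_; toList; fromList)
import Data.Vec.Properties as Vec
open import Function.Base as Function using (_∘_)
open import Function.Bundles using (_⇔_; mk⇔; Equivalence)
open import Level using (0ℓ)
import Relation.Binary.Construct.NonStrictToStrict as Strict
import Relation.Binary.Construct.On as On
open import Relation.Binary.PropositionalEquality using (_≡_; _≢_; refl; sym; trans; cong; cong₂; subst; subst₂; module ≡-Reasoning)
open import Relation.Binary.Structures using (IsDecTotalOrder)
open import Relation.Nullary using (¬_; Dec; does; yes; no; contradiction)
open import Relation.Nullary.Decidable using (toSum; decidable-stable; dec-true; dec-false; ¬?; _×-dec_)
open import Defs

-- The instance of each phase is chosen from the distribution of `A` and not from its random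
-- outcome. The past is therefore a fixed list of events, and the concatenation is one deterministic
-- instance. The imitation lives on the probability space of `A`, so the two costs can be compared
-- outcome by outcome and no conditioning or independence is involved. Its fresh bins are there
-- because an algorithm has to be feasible for every outcome and every instance, while `A` may owe
-- the room in a bin to a migration. Finiteness of the family enters through uniform bounds: one on
-- the cost of an imitation during a phase, one on the number of items per phase. The cost of `A` is
-- not shown to be measurable, so its expectation is a supremum over simple functions below it, for
-- which additivity over the phases is not at hand. Superadditivity suffices, and it only requires
-- that the event of a migration in the phase be measurable. This is why the number of migrations,
-- unlike the cost, is traced through all random decisions, including the delays of repackings
-- between events.

-- Arithmetic and order of the reals, with a ring solver

module RealProperties (R : Reals) where
  open Reals R
  open IsDecTotalOrder isDecTotalOrder public using (antisym; total) renaming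
      (refl to ≤-refl; trans to ≤-trans; reflexive to ≤-reflexive)

  commutativeRing : CommutativeRing _ _
  commutativeRing = record { isCommutativeRing = isCommutativeRing }

  open CommutativeRing commutativeRing public using (+-assoc; +-comm; +-identityˡ; +-identityʳ; *-assoc; *-comm; *-identityˡ; *-identityʳ; zeroˡ; zeroʳ; distribˡ; distribʳ; -‿inverseʳ)
  open RingProperties (CommutativeRing.ring commutativeRing) using (-‿distribˡ-*; -‿distribʳ-*; -‿+-comm; -‿involutive; -0#≈0#)

  fromℕ-+ : ∀ m n → fromℕ (m ℕ.+ n) ≡ fromℕ m + fromℕ n
  fromℕ-+ zero    n = sym (+-identityˡ _)
  fromℕ-+ (suc m) n = trans (cong (1ℝ +_) (fromℕ-+ m n)) (sym (+-assoc _ _ _))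

  fromℕ-* : ∀ m n → fromℕ (m ℕ.* n) ≡ fromℕ m * fromℕ n
  fromℕ-* zero    n = sym (zeroˡ _)
  fromℕ-* (suc m) n = begin
    fromℕ (n ℕ.+ m ℕ.* n)         ≡⟨ fromℕ-+ n _ ⟩
    fromℕ n + fromℕ (m ℕ.* n)     ≡⟨ cong₂ _+_ (sym (*-identityˡ _)) (fromℕ-* m n) ⟩
    1ℝ * fromℕ n + fromℕ m * fromℕ n ≡⟨ distribʳ _ _ _ ⟨
    (1ℝ + fromℕ m) * fromℕ n      ∎
    where open ≡-Reasoning

  private
    +-interchange : ∀ a b c d → (a + b) + (c + d) ≡ (a + c) + (b + d)
    +-interchange a b c d = begin
      (a + b) + (c + d) ≡⟨ +-assoc a b _ ⟩
      a + (b + (c + d)) ≡⟨ cong (a +_) (sym (+-assoc b c d)) ⟩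
      a + ((b + c) + d) ≡⟨ cong (λ z → a + (z + d)) (+-comm b c) ⟩
      a + ((c + b) + d) ≡⟨ cong (a +_) (+-assoc c b d) ⟩
      a + (c + (b + d)) ≡⟨ +-assoc a c _ ⟨
      (a + c) + (b + d) ∎
      where open ≡-Reasoning

    -- Integer coefficients for the ring solver: (m , n) stands for m − n.
    difference : ℕ × ℕ → ℝ
    difference (m , n) = fromℕ m - fromℕ n

    -- Evaluation that yields 0ℝ and 1ℝ on the nose, as required for them to occur in goals.
    ⟦_⟧ᶜ : ℕ × ℕ → ℝ
    ⟦ 0 , 0 ⟧ᶜ = 0ℝ
    ⟦ 1 , 0 ⟧ᶜ = 1ℝ
    ⟦ c     ⟧ᶜ = difference c

    ⟦⟧ᶜ≡difference : ∀ c → ⟦ c ⟧ᶜ ≡ difference c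
    ⟦⟧ᶜ≡difference (0 , 0)           = sym (-‿inverseʳ 0ℝ)
    ⟦⟧ᶜ≡difference (1 , 0)           = sym (trans (cong₂ _+_ (+-identityʳ 1ℝ) -0#≈0#) (+-identityʳ 1ℝ))
    ⟦⟧ᶜ≡difference (0 , suc n)       = refl
    ⟦⟧ᶜ≡difference (1 , suc n)       = refl
    ⟦⟧ᶜ≡difference (suc (suc m) , n) = refl

    difference-cong : ∀ a b c d → a ℕ.+ d ≡ c ℕ.+ b → difference (a , b) ≡ difference (c , d)
    difference-cong a b c d eq = begin
      A - B                     ≡⟨ +-identityʳ _ ⟨
      (A - B) + 0ℝ              ≡⟨ cong₂ _+_ refl (sym (-‿inverseʳ D)) ⟩
      (A - B) + (D - D)         ≡⟨ +-interchange _ _ _ _ ⟩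
      (A + D) + (- B + - D)     ≡⟨ cong₂ _+_ (trans (sym (fromℕ-+ a d)) (trans (cong fromℕ eq) (fromℕ-+ c b))) refl ⟩
      (C + B) + (- B + - D)     ≡⟨ cong₂ _+_ refl (+-comm _ _) ⟩
      (C + B) + (- D + - B)     ≡⟨ +-interchange _ _ _ _ ⟩
      (C - D) + (B - B)         ≡⟨ cong₂ _+_ refl (-‿inverseʳ B) ⟩
      (C - D) + 0ℝ              ≡⟨ +-identityʳ _ ⟩
      C - D                     ∎
      where
      open ≡-Reasoning
      A = fromℕ a
      B = fromℕ b
      C = fromℕ c
      D = fromℕ d

    -- Cancelling makes equal differences equal pairs, so that the coefficients of a normal form
    -- have a single representation.
    cancel : ℕ × ℕ → ℕ × ℕ
    cancel (suc m , suc n) = cancel (m , n)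
    cancel c               = c

    difference-cancel : ∀ c → difference (cancel c) ≡ difference c
    difference-cancel (zero  , n)     = refl
    difference-cancel (suc m , zero)  = refl
    difference-cancel (suc m , suc n) = trans (difference-cancel (m , n)) (difference-cong m n (suc m) (suc n) (ℕ.+-suc m n))

    rawDifferences : RawRing _ _
    rawDifferences = record
      { Carrier = ℕ × ℕ
      ; _≈_     = _≡_
      ; _+_     = λ (a , b) (c , d) → cancel (a ℕ.+ c , b ℕ.+ d)
      ; _*_     = λ (a , b) (c , d) → cancel (a ℕ.* c ℕ.+ b ℕ.* d , a ℕ.* d ℕ.+ b ℕ.* c)
      ; -_      = λ (a , b) → b , a
      ; 0#      = 0 , 0
      ; 1#      = 1 , 0
      }

    open RawRing rawDifferences using () renaming (_+_ to _+ᶜ_; _*_ to _*ᶜ_; -_ to -ᶜ_)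

    +-homoᵈ : ∀ x y → difference (x +ᶜ y) ≡ difference x + difference y
    +-homoᵈ (a , b) (c , d) = trans (difference-cancel (a ℕ.+ c , b ℕ.+ d)) (begin
      fromℕ (a ℕ.+ c) - fromℕ (b ℕ.+ d)              ≡⟨ cong₂ (λ x y → x - y) (fromℕ-+ a c) (fromℕ-+ b d) ⟩
      (fromℕ a + fromℕ c) - (fromℕ b + fromℕ d)      ≡⟨ cong₂ _+_ refl (sym (-‿+-comm _ _)) ⟩
      (fromℕ a + fromℕ c) + (- fromℕ b + - fromℕ d)  ≡⟨ +-interchange _ _ _ _ ⟩
      (fromℕ a - fromℕ b) + (fromℕ c - fromℕ d)      ∎)
      where open ≡-Reasoning

    -‿homoᵈ : ∀ x → difference (-ᶜ x) ≡ - difference x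
    -‿homoᵈ (a , b) = begin
      fromℕ b - fromℕ a          ≡⟨ +-comm _ _ ⟩
      - fromℕ a + fromℕ b        ≡⟨ cong₂ _+_ refl (sym (-‿involutive _)) ⟩
      - fromℕ a + - - fromℕ b    ≡⟨ -‿+-comm _ _ ⟩
      - (fromℕ a - fromℕ b)      ∎
      where open ≡-Reasoning

    *-homoᵈ : ∀ x y → difference (x *ᶜ y) ≡ difference x * difference y
    *-homoᵈ (a , b) (c , d) = trans (difference-cancel (a ℕ.* c ℕ.+ b ℕ.* d , a ℕ.* d ℕ.+ b ℕ.* c)) (begin
      fromℕ (a ℕ.* c ℕ.+ b ℕ.* d) - fromℕ (a ℕ.* d ℕ.+ b ℕ.* c)
        ≡⟨ cong₂ (λ x y → x - y) (trans (fromℕ-+ (a ℕ.* c) _) (cong₂ _+_ (fromℕ-* a c) (fromℕ-* b d)))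
                                 (trans (fromℕ-+ (a ℕ.* d) _) (cong₂ _+_ (fromℕ-* a d) (fromℕ-* b c))) ⟩
      (A * C + B * D) - (A * D + B * C)
        ≡⟨ cong₂ _+_ refl (trans (sym (-‿+-comm _ _)) (+-comm _ _)) ⟩
      (A * C + B * D) + (- (B * C) + - (A * D))
        ≡⟨ trans (+-interchange _ _ _ _) (cong₂ _+_ refl (+-comm _ _)) ⟩
      (A * C + - (B * C)) + (- (A * D) + B * D)
        ≡⟨ cong₂ _+_ (cong (A * C +_) (-‿distribˡ-* B C))
                     (cong₂ _+_ (-‿distribʳ-* A D) (trans (sym (-‿involutive _))
                         (trans (cong -_ (-‿distribˡ-* B D)) (-‿distribʳ-* (- B) D)))) ⟩
      (A * C + - B * C) + (A * - D + - B * - D)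
        ≡⟨ cong₂ _+_ (sym (distribʳ _ _ _)) (sym (distribʳ _ _ _)) ⟩
      (A - B) * C + (A - B) * - D
        ≡⟨ distribˡ _ _ _ ⟨
      (A - B) * (C - D) ∎)
      where
      open ≡-Reasoning
      A = fromℕ a
      B = fromℕ b
      C = fromℕ c
      D = fromℕ d

    homomorphism : rawDifferences -Raw-AlmostCommutative⟶ fromCommutativeRing commutativeRing
    homomorphism = record
      { ⟦_⟧    = ⟦_⟧ᶜ
      ; +-homo = λ x y → trans (⟦⟧ᶜ≡difference (x +ᶜ y)) (trans (+-homoᵈ x y)
          (sym (cong₂ _+_ (⟦⟧ᶜ≡difference x) (⟦⟧ᶜ≡difference y))))
      ; *-homo = λ x y → trans (⟦⟧ᶜ≡difference (x *ᶜ y)) (trans (*-homoᵈ x y)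
          (sym (cong₂ _*_ (⟦⟧ᶜ≡difference x) (⟦⟧ᶜ≡difference y))))
      ; -‿homo = λ x → trans (⟦⟧ᶜ≡difference (-ᶜ x)) (trans (-‿homoᵈ x) (cong -_ (sym (⟦⟧ᶜ≡difference x))))
      ; 0-homo = refl
      ; 1-homo = refl
      }

    _≟ᶜ_ : ∀ x y → Maybe (⟦ x ⟧ᶜ ≡ ⟦ y ⟧ᶜ)
    x@(a , b) ≟ᶜ y@(c , d) with (a ℕ.+ d) ℕ.≟ (c ℕ.+ b)
    ... | yes eq = just (trans (⟦⟧ᶜ≡difference x) (trans (difference-cong a b c d eq) (sym (⟦⟧ᶜ≡difference y))))
    ... | no  _  = nothing

  module Solver = RingSolver rawDifferences (fromCommutativeRing commutativeRing) homomorphism _≟ᶜ_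
  open Solver using (solve; _:=_; _:+_; _:*_; _:-_; con)

  +-monoˡ-≤ : ∀ z {x y} → x ≤ y → x + z ≤ y + z
  +-monoˡ-≤ z {x} {y} x≤y = subst₂ _≤_ (+-comm z x) (+-comm z y) (+-monoʳ-≤ z x≤y)

  +-mono-≤ : ∀ {x y u v} → x ≤ y → u ≤ v → x + u ≤ y + v
  +-mono-≤ {y = y} {u} x≤y u≤v = ≤-trans (+-monoˡ-≤ u x≤y) (+-monoʳ-≤ y u≤v)

  0≤+ : ∀ {x y} → 0ℝ ≤ x → 0ℝ ≤ y → 0ℝ ≤ x + y
  0≤+ 0≤x 0≤y = subst (_≤ _) (+-identityʳ 0ℝ) (+-mono-≤ 0≤x 0≤y)

  ≤⇒0≤- : ∀ {x y} → x ≤ y → 0ℝ ≤ y - x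
  ≤⇒0≤- {x} x≤y = subst (_≤ _) (-‿inverseʳ x) (+-monoˡ-≤ (- x) x≤y)

  ≤-from : ∀ {x y d} → 0ℝ ≤ d → y ≡ x + d → x ≤ y
  ≤-from {x} 0≤d y≡x+d = subst₂ _≤_ (+-identityʳ x) (sym y≡x+d) (+-monoʳ-≤ x 0≤d)

  x≤x+y : ∀ {x y} → 0ℝ ≤ y → x ≤ x + y
  x≤x+y 0≤y = ≤-from 0≤y refl

  +-cancelʳ-≤ : ∀ z {x y} → x + z ≤ y + z → x ≤ y
  +-cancelʳ-≤ z {x} {y} p = ≤-from (≤⇒0≤- p) (solve 3 (λ x y z → y := x :+ ((y :+ z) :- (x :+ z))) refl x y z)

  +-cancelˡ-≤ : ∀ z {x y} → z + x ≤ z + y → x ≤ y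
  +-cancelˡ-≤ z {x} {y} p = +-cancelʳ-≤ z (subst₂ _≤_ (+-comm z x) (+-comm z y) p)

  *-monoʳ-≤ : ∀ {z} → 0ℝ ≤ z → ∀ {x y} → x ≤ y → z * x ≤ z * y
  *-monoʳ-≤ {z} 0≤z {x} {y} x≤y = ≤-from (*-nonNeg 0≤z (≤⇒0≤- x≤y))
      (solve 3 (λ x y z → z :* y := z :* x :+ z :* (y :- x)) refl x y z)

  *-monoˡ-≤ : ∀ {z} → 0ℝ ≤ z → ∀ {x y} → x ≤ y → x * z ≤ y * z
  *-monoˡ-≤ {z} 0≤z {x} {y} x≤y = subst₂ _≤_ (*-comm z x) (*-comm z y) (*-monoʳ-≤ 0≤z x≤y)

  ≰⇒≥ : ∀ {x y} → ¬ x ≤ y → y ≤ x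
  ≰⇒≥ {x} {y} x≰y = [ (λ x≤y → contradiction x≤y x≰y) , (λ y≤x → y≤x) ]′ (total x y)

  ≰⇒> : ∀ {x y} → ¬ x ≤ y → y < x
  ≰⇒> = Strict.≰⇒> _≡_ _≤_ sym ≤-reflexive total

  <⇒≱ : ∀ {x y} → x < y → ¬ y ≤ x
  <⇒≱ = Strict.<⇒≱ _≡_ _≤_ antisym

  ≮⇒≥ : ∀ {x y} → ¬ x < y → y ≤ x
  ≮⇒≥ = Strict.≮⇒≥ _≡_ _≤_ sym _≟_ ≤-reflexive total

  <-≤-trans : ∀ {x y z} → x < y → y ≤ z → x < z
  <-≤-trans x<y y≤z = ≰⇒> λ z≤x → <⇒≱ x<y (≤-trans y≤z z≤x)

  ≤-<-trans : ∀ {x y z} → x ≤ y → y < z → x < z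
  ≤-<-trans x≤y y<z = ≰⇒> λ z≤x → <⇒≱ y<z (≤-trans z≤x x≤y)

  0≤1 : 0ℝ ≤ 1ℝ
  0≤1 with total 0ℝ 1ℝ
  ... | inj₁ 0≤1 = 0≤1
  -- If 1 ≤ 0, then 0 - 1 is non-negative, and its square is 1.
  ... | inj₂ 1≤0 = subst (0ℝ ≤_) (solve 0 ((con (0 , 0) :- con (1 , 0)) :* (con (0 , 0) :- con (1 , 0)) := con (1 , 0)) refl)
      (*-nonNeg (≤⇒0≤- 1≤0) (≤⇒0≤- 1≤0))

  0<1 : 0ℝ < 1ℝ
  0<1 = 0≤1 , 0≢1

  x<1+x : ∀ x → x < 1ℝ + x
  x<1+x x = x≤1+x , λ x≡1+x → 0≢1 (trans (sym (-‿inverseʳ x))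
      (trans (cong (_- x) x≡1+x) (solve 1 (λ x → con (1 , 0) :+ x :- x := con (1 , 0)) refl x)))
    where x≤1+x = ≤-from 0≤1 (+-comm 1ℝ x)

  0≤fromℕ : ∀ n → 0ℝ ≤ fromℕ n
  0≤fromℕ zero    = ≤-refl
  0≤fromℕ (suc n) = 0≤+ 0≤1 (0≤fromℕ n)

  fromℕ-mono : ∀ {m n} → m ℕ.≤ n → fromℕ m ≤ fromℕ n
  fromℕ-mono {n = n} ℕ.z≤n = 0≤fromℕ n
  fromℕ-mono (ℕ.s≤s m≤n)   = +-monoʳ-≤ 1ℝ (fromℕ-mono m≤n)

  0<fromℕ-suc : ∀ n → 0ℝ < fromℕ (suc n)
  0<fromℕ-suc n = <-≤-trans 0<1 (x≤x+y (0≤fromℕ n))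

  *-inverseˡ : ∀ {x} → 0ℝ < x → x ⁻¹ * x ≡ 1ℝ
  *-inverseˡ {x} (_ , 0≢x) = trans (*-comm _ _) (*-inverseʳ x (0≢x ∘ sym))

  0<⁻¹ : ∀ {x} → 0ℝ < x → 0ℝ < x ⁻¹
  0<⁻¹ {x} 0<x = ≰⇒> λ x⁻¹≤0 → <⇒≱ 0<1 (subst₂ _≤_ (*-inverseˡ 0<x) (zeroˡ x) (*-monoˡ-≤ (proj₁ 0<x) x⁻¹≤0))

  0<* : ∀ {x y} → 0ℝ < x → 0ℝ < y → 0ℝ < x * y
  0<* {x} {y} 0<x 0<y = *-nonNeg (proj₁ 0<x) (proj₁ 0<y) , λ 0≡xy → proj₂ 0<y (begin
    0ℝ               ≡⟨ zeroʳ _ ⟨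
    x ⁻¹ * 0ℝ        ≡⟨ cong (x ⁻¹ *_) 0≡xy ⟩
    x ⁻¹ * (x * y)   ≡⟨ *-assoc _ _ _ ⟨
    x ⁻¹ * x * y     ≡⟨ cong (_* y) (*-inverseˡ 0<x) ⟩
    1ℝ * y           ≡⟨ *-identityˡ y ⟩
    y                ∎)
    where open ≡-Reasoning

  -- Otherwise the natural numbers would have a least upper bound s, and s - 1 would bound them as
  -- well. The double negation is there because excluded middle is not assumed in this module.
  archimedean : ∀ x → ¬ ¬ (∃[ n ] x ≤ fromℕ n)
  archimedean x none with complete (λ y → ∃[ n ] y ≡ fromℕ n) (0ℝ , 0 , refl)
      (x , λ { _ (n , refl) → ≰⇒≥ λ x≤n → none (n , x≤n) })
  ... | s , upper , least = <⇒≱ (x<1+x s) (subst (_≤ s) (+-comm s 1ℝ)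
      (+-cancelʳ-≤ (- 1ℝ) (subst (_≤ s - 1ℝ) (solve 1 (λ s → s := s :+ con (1 , 0) :- con (1 , 0)) refl s)
      (least (s - 1ℝ) λ { _ (n , refl) →
          ≤-from (≤⇒0≤- (upper _ (suc n , refl))) (solve 2 (λ s n → s :- con (1 , 0) := n :+
              (s :- (con (1 , 0) :+ n))) refl s (fromℕ n)) }))))

  sum-++ : ∀ xs ys → sum (xs ++ ys) ≡ sum xs + sum ys
  sum-++ []       ys = sym (+-identityˡ _)
  sum-++ (x ∷ xs) ys = trans (cong (x +_) (sum-++ xs ys)) (sym (+-assoc _ _ _))

  0≤sum : ∀ {xs} → All (0ℝ ≤_) xs → 0ℝ ≤ sum xs
  0≤sum []         = ≤-refl
  0≤sum (0≤x ∷ ps) = 0≤+ 0≤x (0≤sum ps)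

-- Finite additivity, and lower integrals tested against combinations of indicators

module Integration (em : ExcludedMiddle 0ℓ) (R : Reals) (space : Probability.ProbabilitySpace R) where
  open Reals R
  open RealProperties R
  open Solver using (solve; _:=_; _:+_; _:*_; _:-_; con; :-_)
  open Probability R using (module ProbabilitySpace)
  open ProbabilitySpace space

  measurable-const : ∀ (P : Set) → Measurable (λ _ → P)
  measurable-const P with em {P}
  ... | yes p = measurable-resp (λ _ → mk⇔ (λ _ → p) (λ _ → tt)) measurable-whole
  ... | no ¬p = measurable-resp (λ _ → mk⇔ (λ ¬⊤ → contradiction tt ¬⊤) (λ p → contradiction p ¬p))
      (measurable-∁ measurable-whole)

  private
    pair : (A B : Ω → Set) → ℕ → Ω → Set
    pair A B 0             = A
    pair A B 1             = B
    pair A B (suc (suc _)) = λ _ → ⊥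

    measurable-pair : ∀ {A B} → Measurable A → Measurable B → ∀ n → Measurable (pair A B n)
    measurable-pair a b 0             = a
    measurable-pair a b 1             = b
    measurable-pair a b (suc (suc _)) = measurable-const ⊥

    pair⇔⊎ : ∀ {A B} ω → (∃[ n ] pair A B n ω) ⇔ (A ω ⊎ B ω)
    pair⇔⊎ ω = mk⇔ (λ { (0 , x) → inj₁ x ; (1 , y) → inj₂ y ; (suc (suc _) , ()) }) [ 0 ,_ , 1 ,_ ]′

  measurable-∪ : ∀ {A B} → Measurable A → Measurable B → Measurable (λ ω → A ω ⊎ B ω)
  measurable-∪ a b = measurable-resp pair⇔⊎ (measurable-⋃ (measurable-pair a b))

  measurable-∩ : ∀ {A B} → Measurable A → Measurable B → Measurable (λ ω → A ω × B ω)
  measurable-∩ {A} {B} a b = measurable-resp (λ ω → mk⇔ (to ω) (λ (x , y) → [ contradiction x , contradiction y ]′))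
    (measurable-∁ (measurable-∪ (measurable-∁ a) (measurable-∁ b)))
    where
    to : ∀ ω → ¬ (¬ A ω ⊎ ¬ B ω) → A ω × B ω
    to ω ¬¬ with em {A ω} | em {B ω}
    ... | yes x | yes y = x , y
    ... | no ¬x | _     = contradiction (inj₁ ¬x) ¬¬
    ... | _     | no ¬y = contradiction (inj₂ ¬y) ¬¬

  -- An empty event is the disjoint union of countably many copies of itself, so the partial sum p +
  -- p of its probabilities is at most p.
  ℙ-empty : ∀ {A} (a : Measurable A) → (∀ ω → ¬ A ω) → ℙ A a ≡ 0ℝ
  ℙ-empty {A} a ¬A = antisym
    (+-cancelˡ-≤ p (subst₂ _≤_ (cong (p +_) (+-identityʳ p)) (trans (sym p≡⋃) (sym (+-identityʳ p)))
        (proj₁ (ℙ-⋃ (λ _ → a) λ _ _ _ ω x _ → ¬A ω x) _ (2 , refl))))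
    (ℙ-nonNeg a)
    where
    p   = ℙ A a
    p≡⋃ = ℙ-resp a (measurable-⋃ (λ (_ : ℕ) → a)) (λ ω → mk⇔ (0 ,_) proj₂)

  private
    sum-tail : ∀ (f : ℕ → ℝ) (g : ℕ → ℕ) → (∀ k → f (g k) ≡ 0ℝ) → ∀ n → sum (map f (applyUpTo g n)) ≡ 0ℝ
    sum-tail f g f≡0 zero    = refl
    sum-tail f g f≡0 (suc n) = trans (cong₂ _+_ (f≡0 0) (sum-tail f (g ∘ suc) (f≡0 ∘ suc) n)) (+-identityʳ 0ℝ)

  -- Countable additivity for A, B and empty events from then on: the partial sums are constant
  -- after two terms.
  ℙ-∪ : ∀ {A B C} (a : Measurable A) (b : Measurable B) (c : Measurable C) →
        (∀ ω → A ω → ¬ B ω) → (∀ ω → C ω ⇔ (A ω ⊎ B ω)) → ℙ C c ≡ ℙ A a + ℙ B b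
  ℙ-∪ {A} {B} {C} a b c disj C⇔ = trans
    (ℙ-resp c (measurable-⋃ m) λ ω → mk⇔ (Equivalence.from (pair⇔⊎ ω) ∘ Equivalence.to (C⇔ ω))
        (Equivalence.from (C⇔ ω) ∘ Equivalence.to (pair⇔⊎ ω)))
    (antisym (proj₂ lub (ℙ A a + ℙ B b) λ { _ (n , refl) → partial n })
             (≤-trans (≤-reflexive (cong (ℙ A a +_) (sym (+-identityʳ _)))) (proj₁ lub _ (2 , refl))))
    where
    m = measurable-pair a b

    disjoint′ : ∀ i j → i ≢ j → ∀ ω → pair A B i ω → ¬ pair A B j ω
    disjoint′ 0 0 i≢j ω x y = i≢j refl
    disjoint′ 0 1 i≢j ω x y = disj ω x y
    disjoint′ 1 0 i≢j ω x y = disj ω y x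
    disjoint′ 1 1 i≢j ω x y = i≢j refl

    lub = ℙ-⋃ m disjoint′

    partial : ∀ n → sum (map (λ k → ℙ (pair A B k) (m k)) (upTo n)) ≤ ℙ A a + ℙ B b
    partial 0             = 0≤+ (ℙ-nonNeg a) (ℙ-nonNeg b)
    partial 1             = +-monoʳ-≤ _ (ℙ-nonNeg b)
    partial (suc (suc n)) = ≤-reflexive (cong (ℙ A a +_) (trans (cong (ℙ B b +_)
      (sum-tail (λ k → ℙ (pair A B k) (m k)) (suc ∘ suc) (λ k → ℙ-empty (m (suc (suc k))) (λ _ ())) n)) (+-identityʳ _)))

  ℙ-split : ∀ {A D} (a : Measurable A) (d : Measurable D) →
            ℙ D d ≡ ℙ (λ ω → D ω × A ω) (measurable-∩ d a) + ℙ (λ ω → D ω × ¬ A ω) (measurable-∩ d (measurable-∁ a))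
  ℙ-split {A} {D} a d = ℙ-∪ _ _ d (λ _ (_ , x) (_ , ¬x) → ¬x x) λ ω → mk⇔ (to ω) [ proj₁ , proj₁ ]′
    where
    to : ∀ ω → D ω → (D ω × A ω) ⊎ (D ω × ¬ A ω)
    to ω x with em {A ω}
    ... | yes y = inj₁ (x , y)
    ... | no ¬y = inj₂ (x , ¬y)

  -- Linear combinations of indicator functions, with no disjointness or sign condition.
  Combination : Set₁
  Combination = List (ℝ × Σ (Ω → Set) Measurable)

  -- The decision is an argument, so that facts about `eval` can be proved by cases on an arbitrary
  -- decision in place of `em`.
  weigh : ∀ {P : Set} → ℝ → Dec P → ℝ
  weigh v (yes _) = v
  weigh v (no _)  = 0ℝ

  eval : Combination → Ω → ℝ
  eval []                 ω = 0ℝ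
  eval ((v , A , _) ∷ ts) ω = weigh v (em {A ω}) + eval ts ω

  𝔼on : ∀ {D} → Measurable D → Combination → ℝ
  𝔼on d []                 = 0ℝ
  𝔼on d ((v , A , a) ∷ ts) = v * ℙ _ (measurable-∩ d a) + 𝔼on d ts

  𝔼 : Combination → ℝ
  𝔼 []                 = 0ℝ
  𝔼 ((v , A , a) ∷ ts) = v * ℙ A a + 𝔼 ts

  𝔼on-split : ∀ {A D} (a : Measurable A) (d : Measurable D) ts →
              𝔼on d ts ≡ 𝔼on (measurable-∩ d a) ts + 𝔼on (measurable-∩ d (measurable-∁ a)) ts
  𝔼on-split a d []                 = sym (+-identityʳ 0ℝ)
  𝔼on-split {A} {D} a d ((v , B , b) ∷ ts) = trans
    (cong₂ (λ p q → v * p + q)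
      (trans (ℙ-split a (measurable-∩ d b)) (cong₂ _+_ (ℙ-resp _ _ λ _ → mk⇔ swapʳ swapʳ) (ℙ-resp _ _ λ _ → mk⇔ swapʳ swapʳ)))
      (𝔼on-split a d ts))
    (solve 5 (λ v p q r s → v :* (p :+ q) :+ (r :+ s) := (v :* p :+ r) :+ (v :* q :+ s)) refl v _ _ _ _)
    where
    swapʳ : ∀ {X Y Z : Set} → (X × Y) × Z → (X × Z) × Y
    swapʳ ((x , y) , z) = (x , z) , y

  -- Recursion step of `𝔼on-nonNeg` and `simpleOn`: splitting the domain along the first event adds
  -- its weight to the constant c on one half and drops it on the other. This handles overlapping
  -- events without a normal form.
  𝔼on-step : ∀ {A D} (a : Measurable A) (d : Measurable D) ts v c →
             ((c + v) * ℙ _ (measurable-∩ d a) + 𝔼on (measurable-∩ d a) ts)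
               + (c * ℙ _ (measurable-∩ d (measurable-∁ a)) + 𝔼on (measurable-∩ d (measurable-∁ a)) ts)
             ≡ c * ℙ D d + 𝔼on d ((v , A , a) ∷ ts)
  𝔼on-step {A} {D} a d ts v c = trans
    (solve 6 (λ c v p q r s → ((c :+ v) :* p :+ r) :+ (c :* q :+ s) := c :* (p :+ q) :+ (v :* p :+ (r :+ s))) refl c v _ _ _ _)
    (sym (cong₂ (λ p q → c * p + (v * ℙ _ (measurable-∩ d a) + q)) (ℙ-split a d) (𝔼on-split a d ts)))

  𝔼on-whole : ∀ ts → 𝔼on measurable-whole ts ≡ 𝔼 ts
  𝔼on-whole []                 = refl
  𝔼on-whole ((v , A , a) ∷ ts) = cong₂ (λ p q → v * p + q) (ℙ-resp _ _ λ _ → mk⇔ proj₂ (tt ,_)) (𝔼on-whole ts)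

  private
    weigh-yes : ∀ {P : Set} v → P → (p? : Dec P) → weigh v p? ≡ v
    weigh-yes v p (yes _) = refl
    weigh-yes v p (no ¬p) = contradiction p ¬p

    weigh-no : ∀ {P : Set} v → ¬ P → (p? : Dec P) → weigh v p? ≡ 0ℝ
    weigh-no v ¬p (yes p) = contradiction p ¬p
    weigh-no v ¬p (no _)  = refl

    eval-in : ∀ {A : Ω → Set} {a : Measurable A} c v ts {ω} → A ω → c + eval ((v , A , a) ∷ ts) ω ≡ (c + v) + eval ts ω
    eval-in c v ts {ω} x = trans (cong (λ w → c + (w + eval ts ω)) (weigh-yes v x em)) (sym (+-assoc c v _))

    eval-out : ∀ {A : Ω → Set} {a : Measurable A} c v ts {ω} → ¬ A ω → c + eval ((v , A , a) ∷ ts) ω ≡ c + eval ts ω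
    eval-out c v ts {ω} x = trans (cong (λ w → c + (w + eval ts ω)) (weigh-no v x em)) (cong (c +_) (+-identityˡ _))

  -- At the end of the recursion the function is a constant c on an intersection of events and
  -- complements. If that set has a point, then c is non-negative; otherwise its probability is 0.
  𝔼on-nonNeg : ∀ {D} (d : Measurable D) c ts → (∀ ω → D ω → 0ℝ ≤ c + eval ts ω) → 0ℝ ≤ c * ℙ D d + 𝔼on d ts
  𝔼on-nonNeg {D} d c [] 0≤ with em {∃ D}
  ... | yes (ω , x) = subst (0ℝ ≤_) (sym (+-identityʳ _)) (*-nonNeg (subst (0ℝ ≤_) (+-identityʳ c) (0≤ ω x)) (ℙ-nonNeg d))
  ... | no  ∄       = ≤-reflexive (sym (trans (+-identityʳ _) (trans (cong (c *_) (ℙ-empty d λ ω x → ∄ (ω , x))) (zeroʳ c))))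
  𝔼on-nonNeg d c ((v , A , a) ∷ ts) 0≤ = subst (0ℝ ≤_) (𝔼on-step a d ts v c) (0≤+
    (𝔼on-nonNeg (measurable-∩ d a) (c + v) ts λ ω (x , y) → subst (0ℝ ≤_) (eval-in {a = a} c v ts y) (0≤ ω x))
    (𝔼on-nonNeg (measurable-∩ d (measurable-∁ a)) c ts λ ω (x , ¬y) → subst (0ℝ ≤_) (eval-out {a = a} c v ts ¬y) (0≤ ω x)))

  eval-++ : ∀ ts us ω → eval (ts ++ us) ω ≡ eval ts ω + eval us ω
  eval-++ []                 us ω = sym (+-identityˡ _)
  eval-++ ((v , A , _) ∷ ts) us ω = trans (cong (weigh v (em {A ω}) +_) (eval-++ ts us ω)) (sym (+-assoc _ _ _))

  𝔼-++ : ∀ ts us → 𝔼 (ts ++ us) ≡ 𝔼 ts + 𝔼 us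
  𝔼-++ []                 us = sym (+-identityˡ _)
  𝔼-++ ((v , A , a) ∷ ts) us = trans (cong (v * ℙ A a +_) (𝔼-++ ts us)) (sym (+-assoc _ _ _))

  negate : Combination → Combination
  negate = map λ (v , E) → - v , E

  eval-negate : ∀ ts ω → eval (negate ts) ω ≡ - eval ts ω
  eval-negate []                 ω = solve 0 (con (0 , 0) := :- con (0 , 0)) refl
  eval-negate ((v , A , _) ∷ ts) ω = trans (cong₂ _+_ (weigh-negate em) (eval-negate ts ω))
    (solve 2 (λ x y → (:- x) :+ (:- y) := :- (x :+ y)) refl _ _)
    where
    weigh-negate : (x? : Dec (A ω)) → weigh (- v) x? ≡ - weigh v x?
    weigh-negate (yes _) = refl
    weigh-negate (no _)  = solve 0 (con (0 , 0) := :- con (0 , 0)) refl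

  𝔼-negate : ∀ ts → 𝔼 (negate ts) ≡ - 𝔼 ts
  𝔼-negate []                 = solve 0 (con (0 , 0) := :- con (0 , 0)) refl
  𝔼-negate ((v , A , a) ∷ ts) = trans (cong (- v * ℙ A a +_) (𝔼-negate ts))
    (solve 3 (λ v p y → (:- v) :* p :+ (:- y) := :- (v :* p :+ y)) refl v _ _)

  -- Positivity of the difference `us ++ negate ts`; for its sake combinations may have negative
  -- weights.
  𝔼-mono : ∀ ts us → (∀ ω → eval ts ω ≤ eval us ω) → 𝔼 ts ≤ 𝔼 us
  𝔼-mono ts us ts≤us = ≤-from
    (subst (0ℝ ≤_)
      (trans (cong₂ _+_ (zeroˡ _) (trans (𝔼on-whole (us ++ negate ts))
          (trans (𝔼-++ us (negate ts)) (cong (𝔼 us +_) (𝔼-negate ts))))) (+-identityˡ _))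
      (𝔼on-nonNeg measurable-whole 0ℝ (us ++ negate ts) λ ω _ →
        subst (0ℝ ≤_) (sym (trans (+-identityˡ _) (trans (eval-++ us (negate ts) ω)
            (cong (eval us ω +_) (eval-negate ts ω))))) (≤⇒0≤- (ts≤us ω))))
    (solve 2 (λ x y → y := x :+ (y :- x)) refl (𝔼 ts) (𝔼 us))

  record SimpleOn (D : Ω → Set) (f : Ω → ℝ) (e : ℝ) : Set₁ where
    field
      parts     : List Piece
      disjoint′ : AllPairs (λ p q → ∀ ω → event p ω → ¬ event q ω) parts
      inside    : All (λ p → ∀ ω → event p ω → D ω) parts
      equal     : All (λ p → ∀ ω → event p ω → value p ≡ f ω) parts
      mean      : sum (map (λ p → value p * ℙ (event p) (measurable p)) parts) ≡ e

  -- Brings a combination into the disjoint form over which `𝔼[_]≤_` quantifies. With non-negative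
  -- weights the accumulated constants stay non-negative.
  simpleOn : ∀ {D} (d : Measurable D) {c} → 0ℝ ≤ c → ∀ ts → All (λ t → 0ℝ ≤ proj₁ t) ts →
             SimpleOn D (λ ω → c + eval ts ω) (c * ℙ D d + 𝔼on d ts)
  simpleOn {D} d {c} 0≤c [] [] = record
    { parts     = record { value = c ; value≥0 = 0≤c ; event = D ; measurable = d } ∷ []
    ; disjoint′ = [] ∷ []
    ; inside    = (λ ω x → x) ∷ []
    ; equal     = (λ ω _ → sym (+-identityʳ c)) ∷ []
    ; mean      = refl
    }
  simpleOn {D} d {c} 0≤c ((v , A , a) ∷ ts) (0≤v ∷ 0≤ts) = record
    { parts     = S.parts ++ T.parts
    ; disjoint′ = AllPairs.++⁺ S.disjoint′ T.disjoint′ (All.map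
        (λ p⊆ → All.map (λ q⊆ ω x y → proj₂ (q⊆ ω y) (proj₂ (p⊆ ω x))) T.inside) S.inside)
    ; inside    = All.++⁺ (All.map (λ p⊆ ω x → proj₁ (p⊆ ω x)) S.inside) (All.map (λ p⊆ ω x → proj₁ (p⊆ ω x)) T.inside)
    ; equal     = All.++⁺
        (All.zipWith (λ (p⊆ , eq) ω x → trans (eq ω x) (sym (eval-in {a = a} c v ts (proj₂ (p⊆ ω x))))) (S.inside , S.equal))
        (All.zipWith (λ (p⊆ , eq) ω x → trans (eq ω x) (sym (eval-out {a = a} c v ts (proj₂ (p⊆ ω x))))) (T.inside , T.equal))
    ; mean      = trans (cong sum (List.map-++ _ S.parts T.parts))
        (trans (sum-++ (map _ S.parts) _) (trans (cong₂ _+_ S.mean T.mean) (𝔼on-step a d ts v c)))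
    }
    where
    module S = SimpleOn (simpleOn (measurable-∩ d a) (0≤+ 0≤c 0≤v) ts 0≤ts)
    module T = SimpleOn (simpleOn (measurable-∩ d (measurable-∁ a)) 0≤c ts 0≤ts)

  𝔼≤-combination : ∀ {X c} → 𝔼[ X ]≤ c → ∀ ts → All (λ t → 0ℝ ≤ proj₁ t) ts → (∀ ω → eval ts ω ≤ X ω) → 𝔼 ts ≤ c
  𝔼≤-combination {X} {c} X≤c ts 0≤ts ts≤X = subst (_≤ c)
    (trans S.mean (trans (cong₂ _+_ (zeroˡ _) (𝔼on-whole ts)) (+-identityˡ _)))
    (X≤c (record { pieces = S.parts ; disjoint = S.disjoint′ })
         (All.map (λ eq ω x → ≤-trans (≤-reflexive (trans (eq ω x) (+-identityˡ _))) (ts≤X ω)) S.equal))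
    where
    module S = SimpleOn (simpleOn measurable-whole ≤-refl ts 0≤ts)

  combination : List Piece → Combination
  combination = map λ p → value p , event p , measurable p

  𝔼-combination : ∀ ps → 𝔼 (combination ps) ≡ sum (map (λ p → value p * ℙ (event p) (measurable p)) ps)
  𝔼-combination []       = refl
  𝔼-combination (p ∷ ps) = cong (_ +_) (𝔼-combination ps)

  combination≥0 : ∀ ps → All (λ t → 0ℝ ≤ proj₁ t) (combination ps)
  combination≥0 []       = []
  combination≥0 (p ∷ ps) = value≥0 p ∷ combination≥0 ps

  -- By disjointness at most one term is nonzero at ω; off all pieces the bound is 0 ≤ X.
  eval-below : ∀ {X} → (∀ ω → 0ℝ ≤ X ω) → ∀ Y → Below Y X → ∀ ω → eval (combination (pieces Y)) ω ≤ X ω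
  eval-below {X} 0≤X Y Y≤X ω = go (pieces Y) (disjoint Y) Y≤X
    where
    off : ∀ p ps → All (λ q → ∀ ω → event p ω → ¬ event q ω) ps → event p ω → eval (combination ps) ω ≡ 0ℝ
    off p []       []       x = refl
    off p (q ∷ qs) (d ∷ ds) x = trans (cong₂ _+_ (weigh-no (value q) (d ω x) em) (off p qs ds x)) (+-identityʳ 0ℝ)

    go : ∀ ps → AllPairs (λ p q → ∀ ω → event p ω → ¬ event q ω) ps → All (λ p → ∀ ω → event p ω → value p ≤ X ω) ps →
         eval (combination ps) ω ≤ X ω
    go []       []       []         = 0≤X ω
    go (p ∷ ps) (d ∷ ds) (p≤X ∷ bs) with em {event p ω}
    ... | yes x = subst (_≤ X ω) (sym (trans (cong (value p +_) (off p ps d x)) (+-identityʳ _))) (p≤X ω x)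
    ... | no ¬x = subst (_≤ X ω) (sym (+-identityˡ _)) (go ps ds bs)

  restrict : ∀ {B} → Measurable B → Combination → Combination
  restrict b = map λ (v , A , a) → v , _ , measurable-∩ a b

  restrict≥0 : ∀ {B} (b : Measurable B) ts → All (λ t → 0ℝ ≤ proj₁ t) ts → All (λ t → 0ℝ ≤ proj₁ t) (restrict b ts)
  restrict≥0 b []       []       = []
  restrict≥0 b (t ∷ ts) (p ∷ ps) = p ∷ restrict≥0 b ts ps

  eval-restrict : ∀ {B} (b : Measurable B) ts {ω} → B ω → eval (restrict b ts) ω ≡ eval ts ω
  eval-restrict b []                 x = refl
  eval-restrict {B} b ((v , A , a) ∷ ts) {ω} x = cong₂ _+_ (eq em em) (eval-restrict b ts x)
    where
    eq : (p? : Dec (A ω × B ω)) (q? : Dec (A ω)) → weigh v p? ≡ weigh v q?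
    eq p? (yes y) = weigh-yes v (y , x) p?
    eq p? (no ¬y) = weigh-no v (¬y ∘ proj₁) p?

  eval-restrict-out : ∀ {B} (b : Measurable B) ts {ω} → ¬ B ω → eval (restrict b ts) ω ≡ 0ℝ
  eval-restrict-out b []                 ¬x = refl
  eval-restrict-out b ((v , A , a) ∷ ts) ¬x = trans (cong₂ _+_ (weigh-no v (λ (_ , x) → ¬x x) em)
      (eval-restrict-out b ts ¬x)) (+-identityʳ 0ℝ)

  -- Only the exceptional event B has to be measurable here: lower integrals are superadditive.
  𝔼≥-superadditive : ∀ {B} (b : Measurable B) {C} → 0ℝ ≤ C → ∀ {X₁ X₂ X} →
    (∀ ω → 0ℝ ≤ X₁ ω) → (∀ ω → 0ℝ ≤ X₂ ω) → (∀ ω → X₂ ω ≤ C) →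
    (∀ ω → X₁ ω ≤ X ω) → (∀ ω → ¬ B ω → X₁ ω + X₂ ω ≤ X ω) →
    ∀ {c₁ c₂} → 𝔼[ X₁ ]≥ c₁ → 𝔼[ X₂ ]≥ c₂ → 𝔼[ X ]≥ (c₁ + c₂ - C * ℙ B b)
  𝔼≥-superadditive {B} b {C} 0≤C {X₁} {X₂} {X} 0≤X₁ 0≤X₂ X₂≤C X₁≤X sum≤X {c₁} {c₂} X₁≥ X₂≥ u X≤u =
    -- `𝔼[_]≥_` speaks only of upper bounds of the integral. So each hypothesis is applied to a
    -- candidate upper bound, which is checked against all `Y₁` and then, with `Y₁` fixed, against
    -- all `Y₂`.
    move (X₁≥ (u + C * ℙ B b - c₂) λ Y₁ Y₁≤ → swap (X₂≥ (u + C * ℙ B b - 𝔼-simple Y₁) λ Y₂ Y₂≤ → bound Y₁ Y₁≤ Y₂ Y₂≤))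
    where
    p = C * ℙ B b

    move : c₁ ≤ u + p - c₂ → c₁ + c₂ - p ≤ u
    move le = ≤-from (≤⇒0≤- le) (solve 4 (λ c₁ c₂ u p → u := (c₁ :+ c₂ :- p) :+ (u :+ p :- c₂ :- c₁)) refl c₁ c₂ u p)

    swap : ∀ {y} → c₂ ≤ u + p - y → y ≤ u + p - c₂
    swap {y} le = ≤-from (≤⇒0≤- le) (solve 4 (λ c₂ u p y → u :+ p :- c₂ := y :+ (u :+ p :- y :- c₂)) refl c₂ u p y)

    bound : ∀ Y₁ → Below Y₁ X₁ → ∀ Y₂ → Below Y₂ X₂ → 𝔼-simple Y₂ ≤ u + p - 𝔼-simple Y₁
    bound Y₁ Y₁≤ Y₂ Y₂≤ = subst₂ (λ x y → y ≤ u + p - x) (𝔼-combination (pieces Y₁)) (𝔼-combination (pieces Y₂))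
      (≤-trans (𝔼-mono ts₂ (ts′ ++ (C , B , b) ∷ []) dominated)
        (≤-trans (≤-reflexive (trans (𝔼-++ ts′ _) (cong (𝔼 ts′ +_) (+-identityʳ _))))
          (≤-from (≤⇒0≤- (subst (_≤ u) (𝔼-++ ts₁ ts′) both))
            (solve 4 (λ x y u p → u :+ p :- x := y :+ p :+ (u :- (x :+ y))) refl (𝔼 ts₁) (𝔼 ts′) u p))))
      where
      ts₁ = combination (pieces Y₁)
      ts₂ = combination (pieces Y₂)
      -- With `Y₂` cut off on B, the sum with `Y₁` lies below X everywhere, and the part cut off has
      -- mean at most C times the probability of B.
      ts′ = restrict (measurable-∁ b) ts₂

      ts₁≤ : ∀ ω → eval ts₁ ω ≤ X₁ ω
      ts₁≤ = eval-below 0≤X₁ Y₁ Y₁≤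

      ts₂≤ : ∀ ω → eval ts₂ ω ≤ X₂ ω
      ts₂≤ = eval-below 0≤X₂ Y₂ Y₂≤

      ts≤X : ∀ ω → eval ts₁ ω + eval ts′ ω ≤ X ω
      ts≤X ω with em {B ω}
      ... | yes x = subst (_≤ X ω) (sym (trans (cong (eval ts₁ ω +_) (eval-restrict-out (measurable-∁ b) ts₂ λ ¬x → ¬x x))
          (+-identityʳ _)))
                      (≤-trans (ts₁≤ ω) (X₁≤X ω))
      ... | no ¬x = ≤-trans (+-mono-≤ (ts₁≤ ω) (subst (_≤ X₂ ω) (sym (eval-restrict (measurable-∁ b) ts₂ ¬x)) (ts₂≤ ω)))
          (sum≤X ω ¬x)

      both : 𝔼 (ts₁ ++ ts′) ≤ u
      both = 𝔼≤-combination X≤u (ts₁ ++ ts′) (All.++⁺ (combination≥0 _) (restrict≥0 _ ts₂ (combination≥0 _)))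
               (λ ω → subst (_≤ X ω) (sym (eval-++ ts₁ ts′ ω)) (ts≤X ω))

      dominated : ∀ ω → eval ts₂ ω ≤ eval (ts′ ++ (C , B , b) ∷ []) ω
      dominated ω = subst (eval ts₂ ω ≤_) (sym (eval-++ ts′ _ ω)) (dominated′ em)
        where
        dominated′ : (x? : Dec (B ω)) → eval ts₂ ω ≤ eval ts′ ω + (weigh C x? + 0ℝ)
        dominated′ (yes x) = ≤-trans (≤-trans (ts₂≤ ω) (X₂≤C ω)) (≤-reflexive (sym
          (trans (cong₂ _+_ (eval-restrict-out (measurable-∁ b) ts₂ λ ¬x → ¬x x) (+-identityʳ C)) (+-identityˡ C))))
        dominated′ (no ¬x) = ≤-reflexive (sym (trans (cong (eval ts′ ω +_) (+-identityʳ 0ℝ))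
            (trans (+-identityʳ _) (eval-restrict (measurable-∁ b) ts₂ ¬x))))

-- Measurability of the number of migrations

module Measurability (em : ExcludedMiddle 0ℓ) (R : Reals) (A : DynamicBinPacking.RandomizedAlgorithm R) where
  open DynamicBinPacking R
  open RealProperties R
  open Solver using (solve; _:=_; _:+_; _:-_; con)
  open RandomizedAlgorithm A
  open Integration em R space

  -- Countability of X, in the form in which it is used.
  Countable : Set → Set₁
  Countable X = ∀ {E : X → Ω → Set} → (∀ x → Measurable (E x)) → Measurable (λ ω → ∃[ x ] E x ω)

  countable-ℕ : Countable ℕ
  countable-ℕ = measurable-⋃

  countable-× : ∀ {X Y} → Countable X → Countable Y → Countable (X × Y)
  countable-× cx cy e = measurable-resp (λ ω → mk⇔ (λ (x , y , p) → (x , y) , p) (λ ((x , y) , p) → x , y , p))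
      (cx λ x → cy λ y → e (x , y))

  countable-Vec : ∀ {X} → Countable X → ∀ n → Countable (Vec X n)
  countable-Vec cx zero    e = measurable-resp (λ ω → mk⇔ ([] ,_) λ { ([] , p) → p }) (e [])
  countable-Vec cx (suc n) e = measurable-resp (λ ω → mk⇔ (λ (x , xs , p) → x ∷ xs , p) λ { (x ∷ xs , p) → x , xs , p })
    (cx λ x → countable-Vec cx n λ xs → e (x ∷ xs))

  countable-List : ∀ {X} → Countable X → Countable (List X)
  countable-List cx {E} e = measurable-resp
    (λ ω → mk⇔ (λ (n , v , p) → toList v , p) (λ (xs , p) → length xs , fromList xs , subst (λ ys → E ys ω)
        (sym (Vec.toList∘fromList xs)) p))
    (countable-ℕ λ n → countable-Vec cx n λ v → e (toList v))

  RandomVariable : ∀ {X : Set} → (Ω → X) → Set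
  RandomVariable f = ∀ x → Measurable (λ ω → f ω ≡ x)

  -- The events f = x cover the space, and on each of them f may be replaced by the constant x.
  measurable-bind : ∀ {X} → Countable X → {f : Ω → X} → RandomVariable f →
                    {E : X → Ω → Set} → (∀ x → Measurable (E x)) → Measurable (λ ω → E (f ω) ω)
  measurable-bind cx {f} rf {E} e = measurable-resp (λ ω → mk⇔ (λ { (_ , refl , p) → p }) (λ p → f ω , refl , p))
    (cx λ x → measurable-∩ (rf x) (e x))

  countable-Repacking : Countable Repacking
  countable-Repacking = countable-List (countable-× countable-ℕ countable-ℕ)

  -- Counts a prefix, as `execute` stops at the first delay that is not before `next`.
  due : ℝ → List ℝ → ℕ
  due next []       = 0
  due next (t ∷ ts) = if does (t <? next) then suc (due next ts) else 0

  due-yes : ∀ next ts {t} → t < next → due next (t ∷ ts) ≡ suc (due next ts)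
  due-yes next ts {t} t<next rewrite dec-true (t <? next) t<next = refl

  due-no : ∀ next ts {t} → ¬ t < next → due next (t ∷ ts) ≡ 0
  due-no next ts {t} t≮next rewrite dec-false (t <? next) t≮next = refl

  -- Only closed orthants are known to be measurable, so t < next is expressed by t ≤ next − 1/(n+1) for some n.
  caps : ℝ → ℕ → List ℕ → List ℝ
  caps next j       []       = []
  caps next zero    (n ∷ ns) = fromℕ n ∷ caps next zero ns
  caps next (suc j) (n ∷ ns) = (next - fromℕ (suc n) ⁻¹) ∷ caps next j ns

  private
    bounded : ∀ x → ∃[ n ] x ≤ fromℕ n
    bounded x = decidable-stable em (archimedean x)

    cap< : ∀ next n → next - fromℕ (suc n) ⁻¹ < next
    cap< next n = ≰⇒> λ le → <⇒≱ (0<⁻¹ (0<fromℕ-suc n)) (≤-from (≤⇒0≤- le)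
      (solve 2 (λ x y → con (0 , 0) := y :+ (x :- y :- x)) refl next (fromℕ (suc n) ⁻¹)))

    <⇒≤cap : ∀ {t next} → t < next → ∃[ n ] t ≤ next - fromℕ (suc n) ⁻¹
    <⇒≤cap {t} {next} t<next = n , ≤-from (≤⇒0≤- inv≤) (solve 3 (λ t x y → x :- y := t :+ (x :- t :- y)) refl t next
        (fromℕ (suc n) ⁻¹))
      where
      d = next - t
      0<d : 0ℝ < d
      0<d = ≰⇒> λ d≤0 → <⇒≱ t<next (≤-from (≤⇒0≤- d≤0) (solve 2 (λ t x → t := x :+ (con (0 , 0) :- (x :- t))) refl t next))
      n = proj₁ (bounded (d ⁻¹))
      d⁻¹≤ : d ⁻¹ ≤ fromℕ (suc n)
      d⁻¹≤ = ≤-trans (proj₂ (bounded (d ⁻¹))) (fromℕ-mono (ℕ.n≤1+n n))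
      m = fromℕ (suc n)
      inv≤ : m ⁻¹ ≤ d
      inv≤ = subst₂ _≤_
        (trans (sym (*-assoc _ _ _)) (trans (cong (_* m ⁻¹) (*-inverseʳ d (proj₂ 0<d ∘ sym))) (*-identityˡ _)))
        (trans (cong (d *_) (trans (*-comm _ _) (*-inverseˡ (0<fromℕ-suc n)))) (*-identityʳ d))
        (*-monoʳ-≤ (proj₁ 0<d) (*-monoˡ-≤ (proj₁ (0<⁻¹ (0<fromℕ-suc n))) d⁻¹≤))

  -- An orthant bounds every coordinate, so the delays after the first j need caps as well: any
  -- natural number above them serves. The union over all choices of `ns` is countable.
  ≤due⇒caps : ∀ next j ds → j ℕ.≤ due next ds → ∃[ ns ] j ℕ.≤ length ns × Pointwise _≤_ ds (caps next j ns)
  ≤due⇒caps next zero    []       z≤n = [] , z≤n , []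
  ≤due⇒caps next zero    (t ∷ ts) z≤n =
    let n , t≤n     = bounded t
        ns , le , pw = ≤due⇒caps next zero ts z≤n
    in n ∷ ns , z≤n , t≤n ∷ pw
  ≤due⇒caps next (suc j) (t ∷ ts) j<  = [ before , (λ t≮next → contradiction
      (subst (suc j ℕ.≤_) (due-no next ts t≮next) j<) λ ()) ]′ (toSum (t <? next))
    where
    before : t < next → ∃[ ns ] suc j ℕ.≤ length ns × Pointwise _≤_ (t ∷ ts) (caps next (suc j) ns)
    before t<next =
      let n , t≤n      = <⇒≤cap t<next
          ns , le , pw = ≤due⇒caps next j ts (ℕ.s≤s⁻¹ (subst (suc j ℕ.≤_) (due-yes next ts t<next) j<))
      in n ∷ ns , s≤s le , t≤n ∷ pw

  caps⇒≤due : ∀ next j ds ns → j ℕ.≤ length ns → Pointwise _≤_ ds (caps next j ns) → j ℕ.≤ due next ds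
  caps⇒≤due next zero    ds       ns       le       pw       = z≤n
  caps⇒≤due next (suc j) (t ∷ ts) (n ∷ ns) (s≤s le) (p ∷ pw) =
    subst (suc j ℕ.≤_) (sym (due-yes next ts (≤-<-trans p (cap< next n)))) (s≤s (caps⇒≤due next j ts ns le pw))

  due-measurable : ∀ h next → RandomVariable (λ ω → due next (map proj₁ (later (policy ω) h)))
  due-measurable h next j = measurable-resp
    (λ ω → mk⇔ (λ (j≤ , j≮) → ℕ.≤-antisym (ℕ.≮⇒≥ j≮) j≤) (λ { refl → ℕ.≤-refl , ℕ.<-irrefl refl }))
    (measurable-∩ (atLeast j) (measurable-∁ (atLeast (suc j))))
    where
    atLeast : ∀ j → Measurable (λ ω → j ℕ.≤ due next (map proj₁ (later (policy ω) h)))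
    atLeast j = measurable-resp (λ ω → mk⇔ (λ (ns , le , pw) → caps⇒≤due next j _ ns le pw) (≤due⇒caps next j _))
      (countable-List countable-ℕ λ ns → measurable-∩ (measurable-const _) (delay-measurable h (caps next j ns)))

  -- What `execute` does up to timing depends only on the repackings and on how many of them are due.
  executeMoved : ℕ → Config → List Repacking → ℕ → ℕ
  executeMoved m c (ms ∷ mss) (suc j) = m ℕ.+ executeMoved (migrations ms c) (repack ms c) mss j
  executeMoved m c _          _       = m ℕ.+ 0

  executeFinal : Config → List Repacking → ℕ → Config
  executeFinal c (ms ∷ mss) (suc j) = executeFinal (repack ms c) mss j
  executeFinal c _          _       = c

  execute-moved : ∀ m now next c l → ℕ.sum (map moved (proj₁ (execute m now next c l))) ≡ executeMoved m c (map proj₂ l)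
      (due next (map proj₁ l))
  execute-moved m now next c []              = refl
  execute-moved m now next c ((t , ms) ∷ ss) with t <? next
  ... | yes t<next rewrite dec-true (t <? next) t<next = cong (m ℕ.+_) (execute-moved (migrations ms c) t next (repack ms c) ss)
  ... | no  t≮next rewrite dec-false (t <? next) t≮next = refl

  execute-final : ∀ m now next c l → proj₂ (execute m now next c l) ≡ executeFinal c (map proj₂ l) (due next (map proj₁ l))
  execute-final m now next c []              = refl
  execute-final m now next c ((t , ms) ∷ ss) with t <? next
  ... | yes t<next rewrite dec-true (t <? next) t<next = execute-final (migrations ms c) t next (repack ms c) ss
  ... | no  t≮next rewrite dec-false (t <? next) t≮next = refl

  traceMoved : Ω → History → Config → List Event → ℕ
  traceMoved ω h c es = ℕ.sum (map moved (trace (policy ω) h c es))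

  -- The predicate is arbitrary so that the induction can absorb the migrations already counted.
  -- Once the repackings, the bin and the number of due repackings are fixed, the run continues from
  -- a constant configuration.
  traceMoved-measurable : ∀ h c es (Q : ℕ → Set) → Measurable (λ ω → Q (traceMoved ω h c es))
  traceMoved-measurable h c []                Q = measurable-const _
  traceMoved-measurable h c (e ∷ [])          Q = measurable-const _
  traceMoved-measurable h c (e ∷ es@(e′ ∷ _)) Q = measurable-resp (λ ω → mk⇔ (subst Q (sym (eq ω))) (subst Q (eq ω)))
    (measurable-bind countable-Repacking (migrate-measurable h₁) λ ms →
     measurable-bind countable-ℕ (place-measurable h₁) λ b →
     measurable-bind (countable-List countable-Repacking) (later-measurable h₁) λ mss →
     measurable-bind countable-ℕ (due-measurable h₁ next) λ j →
     traceMoved-measurable h₁ (final ms b mss j) es (λ n → Q (moved′ ms b mss j ℕ.+ n)))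
    where
    h₁   = h ++ [ e ]
    c₀   = remaining (action e) c
    next = time e′ - time e
    moved′ : Repacking → Bin → List Repacking → ℕ → ℕ
    moved′ ms b = executeMoved (migrations ms c₀) (repack ms c₀ ++ incoming (action e) b)
    final : Repacking → Bin → List Repacking → ℕ → Config
    final ms b = executeFinal (repack ms c₀ ++ incoming (action e) b)
    eq : ∀ ω → let ms = migrate (policy ω) h₁
                   b  = place (policy ω) h₁
                   l  = later (policy ω) h₁
                   j  = due next (map proj₁ l)
               in traceMoved ω h c (e ∷ es) ≡ moved′ ms b (map proj₂ l) j ℕ.+ traceMoved ω h₁ (final ms b (map proj₂ l) j) es
    eq ω = trans (cong ℕ.sum (List.map-++ moved (proj₁ ex) _)) (trans (ℕ.sum-++ (map moved (proj₁ ex)) _)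
      (cong₂ ℕ._+_ (execute-moved _ _ next _ (later (policy ω) h₁))
          (cong (λ c → traceMoved ω h₁ c es) (execute-final _ _ next _ (later (policy ω) h₁)))))
      where
      ms = migrate (policy ω) h₁
      ex = execute (migrations ms c₀) 0ℝ next (repack ms c₀ ++ incoming (action e) (place (policy ω) h₁)) (later (policy ω) h₁)

-- Event lists of concatenated instances

module Events (R : Reals) where
  open DynamicBinPacking R
  open RealProperties R

  private
    O = On.decTotalOrder decTotalOrder time
  open InsertionSort O using (insert; sort)

  insert-++ˡ : ∀ x ys zs → All (λ z → time x ≤ time z) zs → insert x (ys ++ zs) ≡ insert x ys ++ zs
  insert-++ˡ x []       []       []       = refl
  insert-++ˡ x []       (z ∷ zs) (p ∷ ps) with time x ≤? time z
  ... | yes _   = refl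
  ... | no  x≰z = contradiction p x≰z
  insert-++ˡ x (y ∷ ys) zs       ps       with time x ≤? time y
  ... | yes _ = refl
  ... | no  _ = cong (y ∷_) (insert-++ˡ x ys zs ps)

  insert-++ʳ : ∀ x ys zs → All (λ y → time y < time x) ys → insert x (ys ++ zs) ≡ ys ++ insert x zs
  insert-++ʳ x []       zs []       = refl
  insert-++ʳ x (y ∷ ys) zs (p ∷ ps) with time x ≤? time y
  ... | yes x≤y = contradiction x≤y (<⇒≱ p)
  ... | no  _   = cong (y ∷_) (insert-++ʳ x ys zs ps)

  -- Departures are listed before all arrivals, so the events of two phases come interleaved. The
  -- early ones must be strictly earlier, since an insertion stops in front of equal times.
  sort-interleaving : ∀ T {xs ys zs} → Interleaving xs ys zs → All (λ x → time x < T) xs → All (λ y → T ≤ time y) ys →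
                      sort zs ≡ sort xs ++ sort ys
  sort-interleaving T [] [] [] = refl
  sort-interleaving T {x ∷ xs} {ys} (consˡ i) (x<T ∷ ps) qs = trans (cong (insert x) (sort-interleaving T i ps qs))
    (insert-++ˡ x (sort xs) (sort ys) (All.map (≤-trans (proj₁ x<T)) (All-resp-↭ (Perm.↭-sym (Sorting.sort-↭ O ys)) qs)))
  sort-interleaving T {xs} {y ∷ ys} (consʳ i) ps (T≤y ∷ qs) = trans (cong (insert y) (sort-interleaving T i ps qs))
    (insert-++ʳ y (sort xs) (sort ys) (All.map (λ x<T → <-≤-trans x<T T≤y) (All-resp-↭ (Perm.↭-sym (Sorting.sort-↭ O xs)) ps)))

  module _ {f : Event → Event} (mono : ∀ x y → time x ≤ time y → time (f x) ≤ time (f y))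
      (cancel : ∀ x y → time (f x) ≤ time (f y) → time x ≤ time y) where

    insert-map : ∀ x ys → insert (f x) (map f ys) ≡ map f (insert x ys)
    insert-map x []       = refl
    insert-map x (y ∷ ys) with time (f x) ≤? time (f y) | time x ≤? time y
    ... | yes _ | yes _ = refl
    ... | yes p | no ¬q = contradiction (cancel x y p) ¬q
    ... | no ¬p | yes q = contradiction (mono x y q) ¬p
    ... | no _  | no _  = cong (f y ∷_) (insert-map x ys)

    sort-map : ∀ xs → sort (map f xs) ≡ map f (sort xs)
    sort-map []       = refl
    sort-map (x ∷ xs) = trans (cong (insert (f x)) (sort-map xs)) (insert-map x (sort xs))

  departureEvent arrivalEvent : ℕ → Item → Event
  departureEvent n i = depart n at departure i
  arrivalEvent n i   = arrive n (size i) at arrival i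

  enumerate : (ℕ → Item → Event) → List Item → List Event
  enumerate f xs = zipWith f (upTo (length xs)) xs

  -- events I is eventsOf (items I) definitionally; item lists may be empty.
  eventsOf : List Item → List Event
  eventsOf xs = sort (enumerate departureEvent xs ++ enumerate arrivalEvent xs)

  shift : ℕ → ℝ → Event → Event
  shift N T (arrive n s at t) = arrive (N ℕ.+ n) s at (T + t)
  shift N T (depart n at t)   = depart (N ℕ.+ n) at (T + t)

  time-shift : ∀ N T e → time (shift N T e) ≡ T + time e
  time-shift N T (arrive n s at t) = refl
  time-shift N T (depart n at t)   = refl

  delay : ∀ {T} → 0ℝ ≤ T → Item → Item
  delay {T} 0≤T i = record
    { arrival    = T + arrival i
    ; size       = size i
    ; duration   = duration i
    ; arrival≥0  = 0≤+ 0≤T (arrival≥0 i)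
    ; size≥0     = size≥0 i
    ; size≤1     = size≤1 i
    ; duration>0 = duration>0 i
    }

  private
    -- Stated for `applyUpTo g`, because the numbering of a tail no longer starts at 0.
    zipWith-applyUpTo-++ : ∀ (f : ℕ → Item → Event) (g : ℕ → ℕ) xs ys →
      zipWith f (applyUpTo g (length (xs ++ ys))) (xs ++ ys)
        ≡ zipWith f (applyUpTo g (length xs)) xs ++ zipWith f (applyUpTo (g ∘ (length xs ℕ.+_)) (length ys)) ys
    zipWith-applyUpTo-++ f g []       ys = refl
    zipWith-applyUpTo-++ f g (x ∷ xs) ys = cong (f (g 0) x ∷_) (zipWith-applyUpTo-++ f (g ∘ suc) xs ys)

    zipWith-applyUpTo-map : ∀ (f : ℕ → Item → Event) {k : ℕ → ℕ} {p : Item → Item} {q : Event → Event} → (∀ n i → f (k n)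
        (p i) ≡ q (f n i)) →
      ∀ (g : ℕ → ℕ) xs → zipWith f (applyUpTo (k ∘ g) (length (map p xs))) (map p xs) ≡ map q
          (zipWith f (applyUpTo g (length xs)) xs)
    zipWith-applyUpTo-map f eq g []       = refl
    zipWith-applyUpTo-map f eq g (x ∷ xs) = cong₂ _∷_ (eq (g 0) x) (zipWith-applyUpTo-map f eq (g ∘ suc) xs)

    All-zipWith : ∀ {P : Event → Set} (f : ℕ → Item → Event) {Q : Item → Set} → (∀ n {i} → Q i → P (f n i)) → ∀ (g : ℕ → ℕ) {xs} →
      All Q xs → All P (zipWith f (applyUpTo g (length xs)) xs)
    All-zipWith f h g []       = []
    All-zipWith f h g (q ∷ qs) = h (g 0) q ∷ All-zipWith f h (g ∘ suc) qs

    -- Two functions occur so that an arrival leads to the departure of the same item under the same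
    -- number.
    ∈-zipWith⁻ : ∀ (f f′ : ℕ → Item → Event) (g : ℕ → ℕ) xs {e} → e ∈ zipWith f (applyUpTo g (length xs)) xs →
      ∃₂ λ n i → e ≡ f n i × f′ n i ∈ zipWith f′ (applyUpTo g (length xs)) xs
    ∈-zipWith⁻ f f′ g (x ∷ xs) (here refl) = g 0 , x , refl , here refl
    ∈-zipWith⁻ f f′ g (x ∷ xs) (there e∈)  = let n , i , eq , m = ∈-zipWith⁻ f f′ (g ∘ suc) xs e∈ in n , i , eq , there m

    ∈-zipWith⁺ : ∀ (f : ℕ → Item → Event) (g : ℕ → ℕ) {xs i} → i ∈ xs → ∃[ n ] f n i ∈ zipWith f (applyUpTo g (length xs)) xs
    ∈-zipWith⁺ f g (here refl) = g 0 , here refl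
    ∈-zipWith⁺ f g (there i∈)  = let n , m = ∈-zipWith⁺ f (g ∘ suc) i∈ in n , there m

  enumerate-++ : ∀ {T} (0≤T : 0ℝ ≤ T) (f : ℕ → Item → Event) xs ys →
    (∀ n i → f (length xs ℕ.+ n) (delay 0≤T i) ≡ shift (length xs) T (f n i)) →
    enumerate f (xs ++ map (delay 0≤T) ys) ≡ enumerate f xs ++ map (shift (length xs) T) (enumerate f ys)
  enumerate-++ 0≤T f xs ys eq = trans (zipWith-applyUpTo-++ f Function.id xs (map (delay 0≤T) ys))
      (cong (enumerate f xs ++_) (zipWith-applyUpTo-map f eq Function.id ys))

  arrival≤departure : ∀ i → arrival i ≤ departure i
  arrival≤departure i = x≤x+y (proj₁ (duration>0 i))

  arrival<departure : ∀ i → arrival i < departure i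
  arrival<departure i = ≰⇒> λ d≤a → <⇒≱ (duration>0 i) (+-cancelˡ-≤ (arrival i)
      (subst (departure i ≤_) (sym (+-identityʳ _)) d≤a))

  All-eventsOf : ∀ {P : Event → Set} {Q : Item → Set} → (∀ n {i} → Q i → P (departureEvent n i)) → (∀ n {i} → Q i → P
      (arrivalEvent n i)) →
                 ∀ {xs} → All Q xs → All P (eventsOf xs)
  All-eventsOf d a {xs} qs = All-resp-↭ (Perm.↭-sym (Sorting.sort-↭ O _))
      (All.++⁺ (All-zipWith departureEvent d Function.id qs) (All-zipWith arrivalEvent a Function.id qs))

  -- All events of `xs` are strictly before T and all delayed ones at T or later, so sorting keeps
  -- them apart. The shift of item numbers comes from the positions in the joint list.
  eventsOf-++ : ∀ {T} (0≤T : 0ℝ ≤ T) xs ys → All (λ i → departure i < T) xs →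
                eventsOf (xs ++ map (delay 0≤T) ys) ≡ eventsOf xs ++ map (shift (length xs) T) (eventsOf ys)
  eventsOf-++ {T} 0≤T xs ys xs<T = begin
    sort (enumerate departureEvent (xs ++ ys′) ++ enumerate arrivalEvent (xs ++ ys′))
      ≡⟨ cong₂ (λ ds as → sort (ds ++ as))
           (enumerate-++ 0≤T departureEvent xs ys (λ n i → cong (λ t → depart (length xs ℕ.+ n) at t) (+-assoc T _ _)))
           (enumerate-++ 0≤T arrivalEvent xs ys (λ n i → refl)) ⟩
    sort ((enumerate departureEvent xs ++ map sh D) ++ (enumerate arrivalEvent xs ++ map sh A))
      ≡⟨ sort-interleaving T
           (Interleaving⁺.++⁺ (Interleaving.++-linear (enumerate departureEvent xs) (map sh D))
               (Interleaving.++-linear (enumerate arrivalEvent xs) (map sh A)))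
           (All.++⁺ (All-zipWith departureEvent (λ _ p → p) Function.id xs<T)
               (All-zipWith arrivalEvent (λ _ {i} p → ≤-<-trans (arrival≤departure i) p) Function.id xs<T))
           (All.++⁺ (late D (All-zipWith departureEvent (λ _ {i} _ → ≤-trans (arrival≥0 i)
               (arrival≤departure i)) Function.id ys⊤))
                    (late A (All-zipWith arrivalEvent (λ _ {i} _ → arrival≥0 i) Function.id ys⊤))) ⟩
    eventsOf xs ++ sort (map sh D ++ map sh A)
      ≡⟨ cong (λ zs → eventsOf xs ++ sort zs) (List.map-++ sh D A) ⟨
    eventsOf xs ++ sort (map sh (D ++ A))
      ≡⟨ cong (eventsOf xs ++_) (sort-map
           (λ x y x≤y → subst₂ _≤_ (sym (time-shift _ T x)) (sym (time-shift _ T y)) (+-monoʳ-≤ T x≤y))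
           (λ x y x≤y → +-cancelˡ-≤ T (subst₂ _≤_ (time-shift _ T x) (time-shift _ T y) x≤y)) (D ++ A)) ⟩
    eventsOf xs ++ map sh (eventsOf ys) ∎
    where
    open ≡-Reasoning
    ys′ = map (delay 0≤T) ys
    sh  = shift (length xs) T
    D   = enumerate departureEvent ys
    A   = enumerate arrivalEvent ys

    ys⊤ : All (λ _ → ⊤) ys
    ys⊤ = All.universal (λ _ → tt) ys

    late : ∀ es → All (λ e → 0ℝ ≤ time e) es → All (λ e → T ≤ time e) (map sh es)
    late []       []       = []
    late (e ∷ es) (p ∷ ps) = subst (T ≤_) (sym (time-shift _ T e)) (x≤x+y p) ∷ late es ps

  Chronological : List Event → Set
  Chronological = AllPairs (λ e f → time e ≤ time f)

  eventsOf-chronological : ∀ xs → Chronological (eventsOf xs)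
  eventsOf-chronological xs = Linked⇒AllPairs ≤-trans (Sorting.sort-↗ O
      (enumerate departureEvent xs ++ enumerate arrivalEvent xs))

  -- The inequality is strict, so that in chronological order the departure is still ahead when the
  -- item arrives.
  Closed : List Event → Set
  Closed es = ∀ {n s t} → (arrive n s at t) ∈ es → ∃[ t′ ] t < t′ × (depart n at t′) ∈ es

  eventsOf-closed : ∀ xs → Closed (eventsOf xs)
  eventsOf-closed xs e∈ with ∈-++⁻ (enumerate departureEvent xs) (∈-resp-↭ (Sorting.sort-↭ O _) e∈)
  ... | inj₁ e∈D with ∈-zipWith⁻ departureEvent departureEvent Function.id xs e∈D
  ...   | _ , _ , () , _
  eventsOf-closed xs e∈ | inj₂ e∈A with ∈-zipWith⁻ arrivalEvent departureEvent Function.id xs e∈A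
  ...   | n , i , refl , d∈ = departure i , arrival<departure i , ∈-resp-↭ (Perm.↭-sym (Sorting.sort-↭ O _)) (∈-++⁺ˡ d∈)

  departure∈eventsOf : ∀ {xs i} → i ∈ xs → ∃[ n ] departureEvent n i ∈ eventsOf xs
  departure∈eventsOf {xs} i∈ = let n , m = ∈-zipWith⁺ departureEvent Function.id i∈ in
    n , ∈-resp-↭ (Perm.↭-sym (Sorting.sort-↭ O _)) (∈-++⁺ˡ m)

  arrival∈eventsOf : ∀ {xs i} → i ∈ xs → ∃[ n ] arrivalEvent n i ∈ eventsOf xs
  arrival∈eventsOf {xs} i∈ = let n , m = ∈-zipWith⁺ arrivalEvent Function.id i∈ in
    n , ∈-resp-↭ (Perm.↭-sym (Sorting.sort-↭ O _)) (∈-++⁺ʳ (enumerate departureEvent xs) m)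

-- Splitting a run, and periods without migrations

module Traces (R : Reals) where
  open DynamicBinPacking R
  open RealProperties R
  open Solver using (solve; _:=_; _:+_; _:*_; _:-_)
  open Events R

  totalCost : List Period → ℝ
  totalCost ps = sum (map (λ p → fromℕ (nonemptyBins (config p)) * elapsed p) ps)

  totalMoved : List Period → ℕ
  totalMoved ps = ℕ.sum (map moved ps)

  totalCost-++ : ∀ ps qs → totalCost (ps ++ qs) ≡ totalCost ps + totalCost qs
  totalCost-++ ps qs = trans (cong sum (List.map-++ _ ps qs)) (sum-++ (map _ ps) _)

  totalMoved-++ : ∀ ps qs → totalMoved (ps ++ qs) ≡ totalMoved ps ℕ.+ totalMoved qs
  totalMoved-++ ps qs = trans (cong ℕ.sum (List.map-++ _ ps qs)) (ℕ.sum-++ (map _ ps) _)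

  0≤totalCost : ∀ {ps} → All (λ p → 0ℝ ≤ elapsed p) ps → 0ℝ ≤ totalCost ps
  0≤totalCost ps≥0 = 0≤sum (All.map⁺ (All.map (λ {p} 0≤p → *-nonNeg (0≤fromℕ (nonemptyBins (config p))) 0≤p) ps≥0))

  execute-yes : ∀ m now next c {t} ms ss → t < next →
    execute m now next c ((t , ms) ∷ ss) ≡
      (period m c (t - now) ∷ proj₁ (execute (migrations ms c) t next (repack ms c) ss) , proj₂
          (execute (migrations ms c) t next (repack ms c) ss))
  execute-yes m now next c {t} ms ss t<next rewrite dec-true (t <? next) t<next = refl

  execute-no : ∀ m now next c {t} ms ss → ¬ t < next → execute m now next c ((t , ms) ∷ ss) ≡ ([ period m c (next - now) ] , c)
  execute-no m now next c {t} ms ss t≮next rewrite dec-false (t <? next) t≮next = refl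

  execute-elapsed : ∀ m {now next} c l → Linked _≤_ (now ∷ map proj₁ l) → now ≤ next → All (λ p → 0ℝ ≤ elapsed p)
      (proj₁ (execute m now next c l))
  execute-elapsed m c []              _         now≤next = ≤⇒0≤- now≤next ∷ []
  execute-elapsed m {now} {next} c ((t , ms) ∷ ss) (now≤t ∷ lk) now≤next with t <? next
  ... | yes t<next rewrite execute-yes m now next c ms ss t<next = ≤⇒0≤- now≤t ∷ execute-elapsed (migrations ms c)
      (repack ms c) ss lk (proj₁ t<next)
  ... | no  t≮next rewrite execute-no m now next c ms ss t≮next = ≤⇒0≤- now≤next ∷ []

  trace-elapsed : ∀ A h c es → Chronological es → All (λ p → 0ℝ ≤ elapsed p) (trace A h c es)
  trace-elapsed A h c []                _                   = []
  trace-elapsed A h c (e ∷ [])          _                   = []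
  trace-elapsed A h c (e ∷ es@(e′ ∷ _)) ((e≤e′ ∷ _) ∷ chron) =
    All.++⁺ (execute-elapsed _ _ (later A (h ++ [ e ])) (later-sorted A (h ++ [ e ])) (≤⇒0≤- e≤e′)) (trace-elapsed A _ _ es chron)

  map-id-repack : ∀ ms c → map id (repack ms c) ≡ map id c
  map-id-repack ms c = sym (List.map-∘ c)

  map-id-execute : ∀ m now next c l → map id (proj₂ (execute m now next c l)) ≡ map id c
  map-id-execute m now next c []              = refl
  map-id-execute m now next c ((t , ms) ∷ ss) with t <? next
  ... | yes t<next rewrite execute-yes m now next c ms ss t<next = trans
      (map-id-execute (migrations ms c) t next (repack ms c) ss) (map-id-repack ms c)
  ... | no  t≮next rewrite execute-no m now next c ms ss t≮next = refl

  Departing : List Event → ItemId → Set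
  Departing es n = ∃[ t ] (depart n at t) ∈ es

  Closed-tail : ∀ {e es} → Chronological (e ∷ es) → Closed (e ∷ es) → Closed es
  Closed-tail (e≤ ∷ _) closed a∈ with closed (there a∈)
  ... | t′ , t<t′ , here refl = contradiction (All.lookup e≤ a∈) (<⇒≱ t<t′)
  ... | t′ , t<t′ , there d∈  = t′ , t<t′ , d∈

  -- A departure at the head concerns only the item that it removes, and an arriving item has its
  -- departure in the tail.
  departing-step : ∀ e es c b → Closed (e ∷ es) → All (Departing (e ∷ es)) (map id c) →
                   All (Departing es) (map id (remaining (action e) c) ++ map id (incoming (action e) b))
  departing-step (arrive n s at t) es c b closed ps = All.++⁺ (All.map tail ps) (new (closed (here refl)) ∷ [])
    where
    tail : ∀ {m} → Departing ((arrive n s at t) ∷ es) m → Departing es m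
    tail (t′ , there d∈) = t′ , d∈
    new : ∃[ t′ ] t < t′ × (depart n at t′) ∈ ((arrive n s at t) ∷ es) → Departing es n
    new (t′ , _ , there d∈) = t′ , d∈
  departing-step (depart n at t) es c b closed ps = All.++⁺ (All.map⁺
      (All.zipWith (λ {p} → tail p) (All.all-filter kept? c , All.filter⁺ kept? (All.map⁻ ps)))) []
    where
    kept? = λ p → ¬? (id p ℕ.≟ n)
    tail : ∀ p → id p ≢ n × Departing ((depart n at t) ∷ es) (id p) → Departing es (id p)
    tail _ (≢n , _  , here refl) = contradiction refl ≢n
    tail _ (_  , t′ , there d∈)  = t′ , d∈

  arrange : Policy → History → Event → Config → Config
  arrange A h₁ e c = repack (migrate A h₁) (remaining (action e) c) ++ incoming (action e) (place A h₁)

  handle : Policy → History → Event → Config → ℝ → List Period × Config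
  handle A h₁ e c next = execute (migrations (migrate A h₁) (remaining (action e) c)) 0ℝ next (arrange A h₁ e c) (later A h₁)

  departing-handle : ∀ A h₁ e es c next → Closed (e ∷ es) → All (Departing (e ∷ es)) (map id c) →
                     All (Departing es) (map id (proj₂ (handle A h₁ e c next)))
  departing-handle A h₁ e es c next closed ps = subst (All (Departing es)) (sym (begin
    map id (proj₂ (handle A h₁ e c next))                                   ≡⟨ map-id-execute _ 0ℝ next _ (later A h₁) ⟩
    map id (arrange A h₁ e c)                                               ≡⟨ List.map-++ id
        (repack (migrate A h₁) (remaining (action e) c)) _ ⟩
    map id (repack (migrate A h₁) (remaining (action e) c)) ++ new          ≡⟨ cong (_++ new)
        (map-id-repack (migrate A h₁) (remaining (action e) c)) ⟩
    map id (remaining (action e) c) ++ new                                  ∎))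
    (departing-step e es c (place A h₁) closed ps)
    where
    open ≡-Reasoning
    new = map id (incoming (action e) (place A h₁))

  -- By the invariant `Departing` every present item has a departure ahead, so no item is left once
  -- `es` is used up, and the second part starts from the empty packing. The periods in `gap` follow
  -- the last event of `es`; `trace` records them only when another event comes.
  trace-++ : ∀ A h c es fs → Chronological es → Closed es → All (Departing es) (map id c) →
             ∃[ gap ] trace A h c (es ++ fs) ≡ trace A h c es ++ gap ++ trace A (h ++ es) [] fs
  trace-++ A h []      []       fs        chron closed ps       = [] , cong (λ h′ → trace A h′ [] fs) (sym (List.++-identityʳ h))
  trace-++ A h (_ ∷ _) []       fs        chron closed ((_ , ()) ∷ _)
  trace-++ A h c       (e ∷ []) []        chron closed ps       = [] , refl
  trace-++ A h c       (e ∷ []) (f ∷ fs)  chron closed ps       =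
    let h₁       = h ++ [ e ]
        out      = handle A h₁ e c (time f - time e)
        gap , eq = trace-++ A h₁ (proj₂ out) [] (f ∷ fs) [] (λ ()) (departing-handle A h₁ e [] c (time f - time e) closed ps)
    in proj₁ out ++ gap , trans (cong (proj₁ out ++_) (trans eq
        (cong (λ h′ → gap ++ trace A h′ [] (f ∷ fs)) (List.++-identityʳ h₁)))) (sym (List.++-assoc (proj₁ out) gap _))
  trace-++ A h c (e ∷ es@(e′ ∷ es′)) fs chron@(_ ∷ chron′) closed ps =
    let h₁       = h ++ [ e ]
        next     = time e′ - time e
        out      = handle A h₁ e c next
        gap , eq = trace-++ A h₁ (proj₂ out) es fs chron′ (Closed-tail chron closed) (departing-handle A h₁ e es c next closed ps)
    in gap , trans (cong (proj₁ out ++_) (trans eq (cong (λ h′ → trace A h₁ (proj₂ out) es ++ gap ++ trace A h′ [] fs)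
        (List.++-assoc h [ e ] es))))
                   (sym (List.++-assoc (proj₁ out) _ _))

  migrations≡0⇒repack : ∀ ms c → migrations ms c ≡ 0 → repack ms c ≡ c
  migrations≡0⇒repack ms []      none = refl
  migrations≡0⇒repack ms (p ∷ c) none with target ms p ℕ.≟ bin p
  ... | yes eq = cong₂ _∷_ (cong (placed (id p) (weight p)) eq)
                   (migrations≡0⇒repack ms c (trans (cong length
                       (sym (List.filter-reject (λ q → ¬? (target ms q ℕ.≟ bin q)) {xs = c} (λ ≢ → ≢ eq)))) none))
  ... | no  ≢  = contradiction (trans (cong length (sym (List.filter-accept
      (λ q → ¬? (target ms q ℕ.≟ bin q)) {xs = c} ≢))) none) λ ()

  -- Each repacking carried out moves nothing, hence is the identity, and the lengths of the periods
  -- telescope.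
  execute-still : ∀ m now next c l → totalMoved (proj₁ (execute m now next c l)) ≡ 0 →
    m ≡ 0 × totalCost (proj₁ (execute m now next c l)) ≡ fromℕ (nonemptyBins c) * (next - now) × proj₂
        (execute m now next c l) ≡ c
  execute-still m now next c []              none = ℕ.m+n≡0⇒m≡0 m none , +-identityʳ _ , refl
  execute-still m now next c ((t , ms) ∷ ss) none with t <? next
  ... | no  t≮next rewrite execute-no m now next c ms ss t≮next = ℕ.m+n≡0⇒m≡0 m none , +-identityʳ _ , refl
  ... | yes t<next rewrite execute-yes m now next c ms ss t<next =
    let none₁ , cost₁ , final₁ = execute-still (migrations ms c) t next (repack ms c) ss (ℕ.m+n≡0⇒n≡0 m none)
        still                  = migrations≡0⇒repack ms c none₁
    in ℕ.m+n≡0⇒m≡0 m none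
     , trans (cong (fromℕ (nonemptyBins c) * (t - now) +_) (trans cost₁
         (cong (λ c′ → fromℕ (nonemptyBins c′) * (next - t)) still)))
             (solve 4 (λ k x y z → k :* (y :- x) :+ k :* (z :- y) := k :* (z :- x)) refl (fromℕ (nonemptyBins c)) now t next)
     , trans final₁ still

  execute-first : ∀ {P : Config → Set} m now next c l → All (P ∘ config) (proj₁ (execute m now next c l)) → P c
  execute-first m now next c []              (p ∷ _) = p
  execute-first m now next c ((t , ms) ∷ ss) ps with t <? next
  ... | yes t<next rewrite execute-yes m now next c ms ss t<next = All.head ps
  ... | no  t≮next rewrite execute-no m now next c ms ss t≮next = All.head ps

-- The migration-free imitation of a policy

module Imitation (R : Reals) where
  open DynamicBinPacking R
  open RealProperties R
  open Solver using (solve; _:=_; _:+_; _:-_; con)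
  open Events R
  open Traces R

  load-++ : ∀ b c d → load b (c ++ d) ≡ load b c + load b d
  load-++ b c d = trans (cong (sum ∘ map weight) (List.filter-++ (λ p → bin p ℕ.≟ b) c d))
    (trans (cong sum (List.map-++ weight (filter (λ p → bin p ℕ.≟ b) c) _))
        (sum-++ (map weight (filter (λ p → bin p ℕ.≟ b) c)) _))

  load-same : ∀ n s b → load b [ placed n s b ] ≡ s
  load-same n s b = trans (cong (sum ∘ map weight) (List.filter-accept (λ p → bin p ℕ.≟ b) {xs = []} refl)) (+-identityʳ s)

  load-other : ∀ p c {b} → bin p ≢ b → load b (p ∷ c) ≡ load b c
  load-other p c {b} ≢b = cong (sum ∘ map weight) (List.filter-reject (λ p → bin p ℕ.≟ b) {xs = c} ≢b)

  load-here : ∀ p c {b} → bin p ≡ b → load b (p ∷ c) ≡ weight p + load b c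
  load-here p c {b} ≡b = cong (sum ∘ map weight) (List.filter-accept (λ p → bin p ℕ.≟ b) {xs = c} ≡b)

  load-∷-cong : ∀ b p q {c d} → bin p ≡ bin q → weight p ≡ weight q → load b c ≡ load b d → load b (p ∷ c) ≡ load b (q ∷ d)
  load-∷-cong b p q {c} {d} bins weights eq with bin p ℕ.≟ b
  ... | yes ≡b = trans (load-here p c ≡b) (trans (cong₂ _+_ weights eq) (sym (load-here q d (trans (sym bins) ≡b))))
  ... | no  ≢b = trans (load-other p c ≢b) (trans eq (sym (load-other q d (≢b ∘ trans bins))))

  NonNegative : Config → Set
  NonNegative = All (λ p → 0ℝ ≤ weight p)

  load-filter-≤ : ∀ {Q : Placed → Set} (Q? : ∀ p → Dec (Q p)) b {c} → NonNegative c → load b (filter Q? c) ≤ load b c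
  load-filter-≤ Q? b []                 = ≤-refl
  load-filter-≤ Q? b (_∷_ {p} {c} w ws) with Q? p | bin p ℕ.≟ b
  ... | yes q | yes ≡b = subst₂ _≤_ (sym (load-here p (filter Q? c) ≡b)) (sym (load-here p c ≡b))
      (+-monoʳ-≤ _ (load-filter-≤ Q? b ws))
  ... | yes q | no ≢b  = subst₂ _≤_ (sym (load-other p (filter Q? c) ≢b)) (sym (load-other p c ≢b)) (load-filter-≤ Q? b ws)
  ... | no ¬q | yes ≡b = subst (_ ≤_) (sym (load-here p c ≡b)) (≤-trans (load-filter-≤ Q? b ws) (≤-from w (+-comm _ _)))
  ... | no ¬q | no ≢b  = subst (_ ≤_) (sym (load-other p c ≢b)) (load-filter-≤ Q? b ws)

  fresh : Config → Bin
  fresh c = suc (ℕ.sum (map bin c))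

  load-fresh : ∀ c → load (fresh c) c ≡ 0ℝ
  load-fresh c = go c ℕ.≤-refl
    where
    go : ∀ d {n} → ℕ.sum (map bin d) ℕ.≤ n → load (suc n) d ≡ 0ℝ
    go []      le = refl
    go (p ∷ d) le = trans (load-other p d (ℕ.<⇒≢ (ℕ.s≤s (ℕ.≤-trans (ℕ.m≤m+n (bin p) _) le))))
        (go d (ℕ.≤-trans (ℕ.m≤n+m _ (bin p)) le))

  choose : Action → Bin → Config → Bin
  choose (arrive _ s) b c = if does (load b c + s ≤? 1ℝ) then b else fresh c
  choose (depart _)   b c = b

  choose-fits : ∀ n s b c → load b c + s ≤ 1ℝ → choose (arrive n s) b c ≡ b
  choose-fits n s b c fits rewrite dec-true (load b c + s ≤? 1ℝ) fits = refl

  update : Action → Bin → Config → Config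
  update a b c = remaining a c ++ incoming a (choose a b (remaining a c))

  simulate : Policy → History → Config → List Event → Config
  simulate A h c []       = c
  simulate A h c (e ∷ es) = simulate A (h ++ [ e ]) (update (action e) (place A (h ++ [ e ])) c) es

  -- `simulate` consumes events from the front, whereas the history of a run grows at its end.
  simulate-∷ʳ : ∀ A h c es e → simulate A h c (es ++ [ e ]) ≡ update (action e) (place A (h ++ es ++ [ e ])) (simulate A h c es)
  simulate-∷ʳ A h c []        e = refl
  simulate-∷ʳ A h c (e′ ∷ es) e = trans (simulate-∷ʳ A (h ++ [ e′ ]) (update (action e′) (place A (h ++ [ e′ ])) c) es e)
    (cong (λ h′ → update (action e) (place A h′) (simulate A (h ++ [ e′ ])
        (update (action e′) (place A (h ++ [ e′ ])) c) es)) (List.++-assoc h [ e′ ] _))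

  lastBin : Config → Bin
  lastBin []          = 0
  lastBin (p ∷ [])    = bin p
  lastBin (_ ∷ q ∷ c) = lastBin (q ∷ c)

  lastBin-∷ʳ : ∀ c p → lastBin (c ++ [ p ]) ≡ bin p
  lastBin-∷ʳ []          p = refl
  lastBin-∷ʳ (_ ∷ [])    p = refl
  lastBin-∷ʳ (_ ∷ q ∷ c) p = lastBin-∷ʳ (q ∷ c) p

  stationary : (History → Bin) → Policy
  stationary f = record { place = f ; migrate = λ _ → [] ; later = λ _ → [] ; later-sorted = λ _ → [-] }

  migrations-[] : ∀ c → migrations [] c ≡ 0
  migrations-[] c = cong length (List.filter-none (λ p → ¬? (bin p ℕ.≟ bin p)) (All.universal (λ _ ≢ → ≢ refl) c))

  repack-[] : ∀ c → repack [] c ≡ c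
  repack-[] = List.map-id

  stationary-moved : ∀ f h c es → totalMoved (trace (stationary f) h c es) ≡ 0
  stationary-moved f h c []                = refl
  stationary-moved f h c (e ∷ [])          = refl
  stationary-moved f h c (e ∷ es@(_ ∷ _)) = cong₂ ℕ._+_ (migrations-[] (remaining (action e) c)) (stationary-moved f _ _ es)

  trace-stationary : ∀ f h c e e′ es →
    let c₁ = remaining (action e) c ++ incoming (action e) (f (h ++ [ e ])) in
    trace (stationary f) h c (e ∷ e′ ∷ es) ≡ period 0 c₁ (time e′ - time e - 0ℝ) ∷ trace (stationary f) (h ++ [ e ]) c₁ (e′ ∷ es)
  trace-stationary f h c e e′ es rewrite migrations-[] (remaining (action e) c) | repack-[] (remaining (action e) c) = refl

  span : List Event → ℝ
  span []                = 0ℝ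
  span (e ∷ [])          = 0ℝ
  span (e ∷ es@(e′ ∷ _)) = time e′ - time e + span es

  nonemptyBins≤length : ∀ c → nonemptyBins c ℕ.≤ length c
  nonemptyBins≤length c = subst (nonemptyBins c ℕ.≤_) (List.length-map bin c) (List.length-deduplicate ℕ._≟_ (map bin c))

  length-remaining : ∀ a c → length (remaining a c) ℕ.≤ length c
  length-remaining (arrive _ _) c = ℕ.≤-refl
  length-remaining (depart n)   c = List.length-filter (λ p → ¬? (id p ℕ.≟ n)) c

  length-incoming : ∀ a b → length (incoming a b) ℕ.≤ 1
  length-incoming (arrive _ _) b = ℕ.≤-refl
  length-incoming (depart _)   b = ℕ.z≤n

  -- An event adds at most one item, so the number of items present plus the number of events ahead
  -- never grows. Hence L bounds the number of nonempty bins throughout, whatever the placements,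
  -- and the bound is uniform over the randomness.
  stationary-cost-≤ : ∀ f h c es L → Chronological es → length c ℕ.+ length es ℕ.≤ L → totalCost
      (trace (stationary f) h c es) ≤ fromℕ L * span es
  stationary-cost-≤ f h c []                 L _ _ = ≤-reflexive (sym (zeroʳ _))
  stationary-cost-≤ f h c (e ∷ [])           L _ _ = ≤-reflexive (sym (zeroʳ _))
  stationary-cost-≤ f h c (e ∷ es@(e′ ∷ es′)) L ((e≤e′ ∷ _) ∷ chron) le = begin≤
    where
    c₁ = remaining (action e) c ++ incoming (action e) (f (h ++ [ e ]))
    d  = time e′ - time e

    le₁ : length c₁ ℕ.+ length es ℕ.≤ L
    le₁ = ℕ.≤-trans (ℕ.+-monoˡ-≤ (length es) (ℕ.≤-trans (ℕ.≤-reflexive (List.length-++ (remaining (action e) c)))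
            (ℕ.≤-trans (ℕ.+-mono-≤ (length-remaining (action e) c) (length-incoming (action e) (f (h ++ [ e ]))))
                (ℕ.≤-reflexive (ℕ.+-comm (length c) 1)))))
          (ℕ.≤-trans (ℕ.≤-reflexive (sym (ℕ.+-suc (length c) (length es)))) le)

    k≤L : fromℕ (nonemptyBins c₁) ≤ fromℕ L
    k≤L = fromℕ-mono (ℕ.≤-trans (nonemptyBins≤length c₁) (ℕ.≤-trans (ℕ.m≤m+n _ (length es)) le₁))

    begin≤ : totalCost (trace (stationary f) h c (e ∷ es)) ≤ fromℕ L * span (e ∷ es)
    begin≤ = ≤-trans (≤-reflexive (cong totalCost (trace-stationary f h c e e′ es′)))
      (≤-trans (+-mono-≤
        (≤-trans (≤-reflexive (cong (fromℕ (nonemptyBins c₁) *_) (solve 1 (λ d → d :- con (0 , 0) := d) refl d)))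
            (*-monoˡ-≤ (≤⇒0≤- e≤e′) k≤L))
        (stationary-cost-≤ f (h ++ [ e ]) c₁ es L chron le₁))
      (≤-reflexive (sym (distribˡ _ _ _))))

  relabel : ℕ → Placed → Placed
  relabel N p = record p { id = N ℕ.+ id p }

  remaining-relabel : ∀ N T e c → remaining (action (shift N T e)) (map (relabel N) c) ≡ map (relabel N) (remaining (action e) c)
  remaining-relabel N T (arrive _ _ at _) c = refl
  remaining-relabel N T (depart n at _)   c = go c
    where
    Q? = λ p → ¬? (id p ℕ.≟ n)
    Q?′ = λ p → ¬? (id p ℕ.≟ N ℕ.+ n)
    go : ∀ c → filter Q?′ (map (relabel N) c) ≡ map (relabel N) (filter Q? c)
    go []      = refl
    go (p ∷ c) with id p ℕ.≟ n
    ... | yes ≡n = trans (List.filter-reject Q?′ (λ ≢n → ≢n (cong (N ℕ.+_) ≡n)))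
        (trans (go c) (cong (map (relabel N)) (sym (List.filter-reject Q? {xs = c} (λ ≢n → ≢n ≡n)))))
    ... | no  ≢n = trans (List.filter-accept Q?′ (λ eq → ≢n (ℕ.+-cancelˡ-≡ N _ _ eq)))
        (trans (cong (relabel N p ∷_) (go c)) (cong (map (relabel N)) (sym (List.filter-accept Q? {xs = c} ≢n))))

  incoming-relabel : ∀ N T e b → incoming (action (shift N T e)) b ≡ map (relabel N) (incoming (action e) b)
  incoming-relabel N T (arrive _ _ at _) b = refl
  incoming-relabel N T (depart _ at _)   b = refl

  load-relabel : ∀ N b c → load b (map (relabel N) c) ≡ load b c
  load-relabel N b []      = refl
  load-relabel N b (p ∷ c) = load-∷-cong b (relabel N p) p refl refl (load-relabel N b c)

  map-bin-relabel : ∀ N c → map bin (map (relabel N) c) ≡ map bin c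
  map-bin-relabel N c = sym (List.map-∘ c)

  -- `choose` looks only at weights and bins, which relabelling preserves.
  choose-relabel : ∀ N T e b c → choose (action (shift N T e)) b (map (relabel N) c) ≡ choose (action e) b c
  choose-relabel N T (arrive _ s at _) b c = cong₂ (λ x f → if does (x + s ≤? 1ℝ) then b else f) (load-relabel N b c)
      (cong (suc ∘ ℕ.sum) (map-bin-relabel N c))
  choose-relabel N T (depart _ at _)   b c = refl

  update-relabel : ∀ N T e b c → update (action (shift N T e)) b (map (relabel N) c) ≡ map (relabel N) (update (action e) b c)
  update-relabel N T e b c = begin
    remaining a′ (map r c) ++ incoming a′ (choose a′ b (remaining a′ (map r c)))
      ≡⟨ cong (λ d → d ++ incoming a′ (choose a′ b d)) (remaining-relabel N T e c) ⟩
    map r (remaining a c) ++ incoming a′ (choose a′ b (map r (remaining a c)))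
      ≡⟨ cong (λ x → map r (remaining a c) ++ incoming a′ x) (choose-relabel N T e b (remaining a c)) ⟩
    map r (remaining a c) ++ incoming a′ (choose a b (remaining a c))
      ≡⟨ cong (map r (remaining a c) ++_) (incoming-relabel N T e _) ⟩
    map r (remaining a c) ++ map r (incoming a (choose a b (remaining a c)))
      ≡⟨ List.map-++ r (remaining a c) _ ⟨
    map r (update a b c) ∎
    where
    open ≡-Reasoning
    a  = action e
    a′ = action (shift N T e)
    r  = relabel N

  -- After the history H, item n and time t of the imitation are item N + n and time T + t of A.
  -- The bin is read off the simulated packing, in which the newest item comes last.
  module _ (A : Policy) (H : History) (N : ℕ) (T : ℝ) where

    imitate : History → Bin
    imitate h = lastBin (simulate A H [] (map (shift N T) h))

    Simulated : History → Config → Set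
    Simulated h c = simulate A H [] (map (shift N T) h) ≡ map (relabel N) c

    advice : History → Event → Bin
    advice h e = place A (H ++ map (shift N T) (h ++ [ e ]))

    simulate-step : ∀ {h c} e → Simulated h c → simulate A H [] (map (shift N T) (h ++ [ e ])) ≡ map (relabel N)
        (update (action e) (advice h e) c)
    simulate-step {h} {c} e sim = begin
      simulate A H [] (map sh (h ++ [ e ]))                         ≡⟨ cong (simulate A H []) (List.map-++ sh h [ e ]) ⟩
      simulate A H [] (map sh h ++ [ sh e ])                        ≡⟨ simulate-∷ʳ A H [] (map sh h) (sh e) ⟩
      update (action (sh e)) (place A (H ++ map sh h ++ [ sh e ])) (simulate A H [] (map sh h))
        ≡⟨ cong₂ (λ x d → update (action (sh e)) (place A (H ++ x)) d) (sym (List.map-++ sh h [ e ])) sim ⟩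
      update (action (sh e)) (advice h e) (map (relabel N) c)       ≡⟨ update-relabel N T e (advice h e) c ⟩
      map (relabel N) (update (action e) (advice h e) c)            ∎
      where
      open ≡-Reasoning
      sh = shift N T

    -- The newest item stands last in the simulated packing, so `lastBin` returns the bin just
    -- chosen for it. At a departure nothing is placed.
    imitate-step : ∀ {h c} e → Simulated h c → remaining (action e) c ++ incoming (action e) (imitate (h ++ [ e ])) ≡ update
        (action e) (advice h e) c
    imitate-step {h} {c} e@(depart n at t)   sim = refl
    imitate-step {h} {c} e@(arrive n s at t) sim = cong (λ b → c ++ [ placed n s b ]) (begin
      lastBin (simulate A H [] (map (shift N T) (h ++ [ e ])))       ≡⟨ cong lastBin (simulate-step e sim) ⟩
      lastBin (map (relabel N) (update (action e) (advice h e) c))   ≡⟨ cong lastBin (List.map-++ (relabel N) c _) ⟩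
      lastBin (map (relabel N) c ++ [ _ ])                           ≡⟨ lastBin-∷ʳ (map (relabel N) c) _ ⟩
      choose (action e) (advice h e) c                               ∎)
      where open ≡-Reasoning

    trace-imitate : ∀ {h c} e e′ es → Simulated h c →
      let c₁ = update (action e) (advice h e) c in
      trace (stationary imitate) h c (e ∷ e′ ∷ es) ≡ period 0 c₁ (time e′ - time e - 0ℝ) ∷ trace (stationary imitate)
          (h ++ [ e ]) c₁ (e′ ∷ es)
    trace-imitate {h} {c} e e′ es sim = trans (trace-stationary imitate h c e e′ es)
      (cong (λ c₁ → period 0 c₁ (time e′ - time e - 0ℝ) ∷ trace (stationary imitate) (h ++ [ e ]) c₁ (e′ ∷ es))
          (imitate-step e sim))

  ValidSize : Event → Set
  ValidSize (arrive _ s at _) = 0ℝ ≤ s × s ≤ 1ℝ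
  ValidSize (depart _ at _)   = ⊤

  update-nonNegative : ∀ e b {c} → ValidSize e → NonNegative c → NonNegative (update (action e) b c)
  update-nonNegative (arrive _ _ at _) b (0≤s , _) ws = All.++⁺ ws (0≤s ∷ [])
  update-nonNegative (depart n at _)   b _         ws = All.++⁺ (All.filter⁺ (λ p → ¬? (id p ℕ.≟ n)) ws) []

  -- An arrival raises the load of one bin only: either the item passed the test there, or the bin
  -- was empty and the size is at most 1. A departure removes non-negative weight.
  update-feasible : ∀ e b {c} → ValidSize e → NonNegative c → Feasible c → Feasible (update (action e) b c)
  update-feasible (depart n at _)   b {c} _       ws feas b′ = ≤-trans
    (≤-reflexive (cong (load b′) (List.++-identityʳ (remaining (depart n) c))))
        (≤-trans (load-filter-≤ (λ p → ¬? (id p ℕ.≟ n)) b′ ws) (feas b′))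
  update-feasible (arrive n s at _) b {c} (_ , s≤1) ws feas b′ = subst (_≤ 1ℝ) (sym (load-++ b′ c _)) bound
    where
    x = choose (arrive n s) b c

    fits : load x c + s ≤ 1ℝ
    fits with load b c + s ≤? 1ℝ
    ... | yes p = p
    ... | no  _ = ≤-trans (≤-reflexive (trans (cong (_+ s) (load-fresh c)) (+-identityˡ s))) s≤1

    bound : load b′ c + load b′ [ placed n s x ] ≤ 1ℝ
    bound with x ℕ.≟ b′
    ... | yes refl = subst (λ y → load x c + y ≤ 1ℝ) (sym (load-same n s x)) fits
    ... | no  ≢b′  = subst (λ y → load b′ c + y ≤ 1ℝ) (sym (load-other (placed n s x) [] ≢b′))
        (subst (_≤ 1ℝ) (sym (+-identityʳ _)) (feas b′))

  imitate-feasible : ∀ A H N T {h c} es → Simulated A H N T h c → All ValidSize es → NonNegative c → Feasible c →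
                     All (Feasible ∘ config) (trace (stationary (imitate A H N T)) h c es)
  imitate-feasible A H N T []                 sim _        ws feas = []
  imitate-feasible A H N T (e ∷ [])           sim _        ws feas = []
  imitate-feasible A H N T {h} {c} (e ∷ es@(e′ ∷ es′)) sim (v ∷ vs) ws feas =
    subst (All (Feasible ∘ config)) (sym (trace-imitate A H N T e e′ es′ sim))
      (update-feasible e b v ws feas ∷ imitate-feasible A H N T es (simulate-step A H N T e sim) vs
          (update-nonNegative e b v ws) (update-feasible e b v ws feas))
    where
    b = advice A H N T h e

  -- Feasibility at bin b is precisely the test made by `choose`.
  update-follows : ∀ a b c → Feasible (remaining a c ++ incoming a b) → update a b c ≡ remaining a c ++ incoming a b
  update-follows (depart _)   b c feas = refl
  update-follows (arrive n s) b c feas = cong (λ x → c ++ [ placed n s x ])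
    (choose-fits n s b c (subst (_≤ 1ℝ) (trans (load-++ b c _) (cong (load b c +_) (load-same n s b))) (feas b)))

  -- Both packings stay equal up to relabelling. Without migrations, `A` changes its packing only by
  -- placing or removing the item of the event; as `A` is feasible, its bin has room, so the
  -- imitation takes the same one.
  imitate-cost : ∀ A H N T {h c} es → Simulated A H N T h c →
    let ps = trace A (H ++ map (shift N T) h) (map (relabel N) c) (map (shift N T) es) in
    All (Feasible ∘ config) ps → totalMoved ps ≡ 0 → totalCost ps ≡ totalCost (trace (stationary (imitate A H N T)) h c es)
  imitate-cost A H N T []                 sim feas still = refl
  imitate-cost A H N T (e ∷ [])           sim feas still = refl
  imitate-cost A H N T {h} {c} (e ∷ es@(e′ ∷ es′)) sim feas still = begin
    totalCost (proj₁ out ++ rest)                         ≡⟨ totalCost-++ (proj₁ out) rest ⟩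
    totalCost (proj₁ out) + totalCost rest                ≡⟨ cong₂ _+_ cost₁
        (cong (λ c₂ → totalCost (trace A h₁ c₂ (map sh es))) final) ⟩
    fromℕ (nonemptyBins c₁) * (next - 0ℝ) + totalCost (trace A h₁ c₁ (map sh es))
      ≡⟨ cong₂ (λ x t → x * (t - 0ℝ) + totalCost (trace A h₁ c₁ (map sh es))) (cong fromℕ bins) next≡ ⟩
    fromℕ (nonemptyBins c′) * (time e′ - time e - 0ℝ) + totalCost (trace A h₁ c₁ (map sh es))
      ≡⟨ cong (fromℕ (nonemptyBins c′) * (time e′ - time e - 0ℝ) +_) (trans
           (cong₂ (λ x y → totalCost (trace A x y (map sh es))) h₁≡ c₁≡)
           (imitate-cost A H N T es (simulate-step A H N T e sim)
             (subst (All (Feasible ∘ config)) rest≡ (All.++⁻ʳ (proj₁ out) feas))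
             (trans (cong totalMoved (sym rest≡)) (ℕ.m+n≡0⇒n≡0 (totalMoved (proj₁ out)) still′)))) ⟩
    fromℕ (nonemptyBins c′) * (time e′ - time e - 0ℝ) + totalCost (trace (stationary (imitate A H N T)) (h ++ [ e ]) c′ es)
      ≡⟨ cong totalCost (trace-imitate A H N T e e′ es′ sim) ⟨
    totalCost (trace (stationary (imitate A H N T)) h c (e ∷ es)) ∎
    where
    open ≡-Reasoning
    sh   = shift N T
    h₁   = (H ++ map sh h) ++ [ sh e ]
    next = time (sh e′) - time (sh e)
    out  = handle A h₁ (sh e) (map (relabel N) c) next
    c₁   = arrange A h₁ (sh e) (map (relabel N) c)
    rest = trace A h₁ (proj₂ out) (map sh es)
    c′   = update (action e) (advice A H N T h e) c

    still′ : totalMoved (proj₁ out) ℕ.+ totalMoved rest ≡ 0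
    still′ = trans (sym (totalMoved-++ (proj₁ out) rest)) still

    executed = execute-still _ 0ℝ next c₁ (later A h₁) (ℕ.m+n≡0⇒m≡0 (totalMoved (proj₁ out)) still′)
    cost₁    = proj₁ (proj₂ executed)
    final    = proj₂ (proj₂ executed)

    h₁≡ : h₁ ≡ H ++ map sh (h ++ [ e ])
    h₁≡ = trans (List.++-assoc H (map sh h) _) (cong (H ++_) (sym (List.map-++ sh h [ e ])))

    b = place A h₁

    c₁≡′ : c₁ ≡ map (relabel N) (remaining (action e) c ++ incoming (action e) b)
    c₁≡′ = trans (cong₂ _++_ (trans (migrations≡0⇒repack (migrate A h₁) (remaining (action (sh e)) (map (relabel N) c))
        (proj₁ executed)) (remaining-relabel N T e c)) (incoming-relabel N T e b))
                 (sym (List.map-++ (relabel N) (remaining (action e) c) _))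

    -- Feasibility of `A` is known for recorded periods, and the first of them shows the packing
    -- right after the event.
    feas₁ : Feasible (remaining (action e) c ++ incoming (action e) b)
    feas₁ x = subst (_≤ 1ℝ) (trans (cong (load x) c₁≡′) (load-relabel N x (remaining (action e) c ++ incoming (action e) b)))
                (execute-first {P = Feasible} _ 0ℝ next c₁ (later A h₁) (All.++⁻ˡ (proj₁ out) feas) x)

    c₁≡ : c₁ ≡ map (relabel N) c′
    c₁≡ = trans c₁≡′ (cong (map (relabel N)) (trans (sym (update-follows (action e) b c feas₁))
        (cong (λ h′ → update (action e) (place A h′) c) h₁≡)))

    bins : nonemptyBins c₁ ≡ nonemptyBins c′
    bins = cong (length ∘ deduplicate ℕ._≟_) (trans (cong (map bin) c₁≡) (map-bin-relabel N c′))

    rest≡ : rest ≡ trace A (H ++ map sh (h ++ [ e ])) (map (relabel N) c′) (map sh es)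
    rest≡ = trans (cong (λ c₂ → trace A h₁ c₂ (map sh es)) final) (cong₂ (λ x y → trace A x y (map sh es)) h₁≡ c₁≡)

    next≡ : next ≡ time e′ - time e
    next≡ = trans (cong₂ (λ x y → x - y) (time-shift N T e′) (time-shift N T e))
        (solve 3 (λ t x y → t :+ x :- (t :+ y) := x :- y) refl T (time e′) (time e))

-- Additivity of OPT over phases, and its growth

module Optimum (R : Reals) where
  open DynamicBinPacking R
  open RealProperties R
  open Solver using (solve; _:=_; _:+_; _:*_; _:-_; con)
  open Events R

  Present : ℝ → Item → Set
  Present t i = arrival i ≤ t × t < departure i

  present? : ∀ t i → Dec (Present t i)
  present? t i = (arrival i ≤? t) ×-dec (t <? departure i)

  sizesAt : List Item → ℝ → List ℝ
  sizesAt xs t = map size (filter (present? t) xs)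

  binsAt : List Item → ℝ → ℝ
  binsAt xs t = fromℕ (minBins (sizesAt xs t))

  -- OPT I is optimum (items I) definitionally.
  optimum : List Item → ℝ
  optimum xs = integrate (binsAt xs) (map time (eventsOf xs))

  integrate-cong : ∀ {f g} {ts} → All (λ t → f t ≡ g t) ts → integrate f ts ≡ integrate g ts
  integrate-cong []               = refl
  integrate-cong (_ ∷ [])         = refl
  integrate-cong (eq ∷ eqs@(_ ∷ _)) = cong₂ _+_ (cong (_* _) eq) (integrate-cong eqs)

  integrate-translate : ∀ f T ts → integrate f (map (T +_) ts) ≡ integrate (λ t → f (T + t)) ts
  integrate-translate f T []                = refl
  integrate-translate f T (t ∷ [])          = refl
  integrate-translate f T (t ∷ ts@(t′ ∷ _)) = cong₂ _+_
    (cong (f (T + t) *_) (solve 3 (λ T x y → T :+ y :- (T :+ x) := y :- x) refl T t t′)) (integrate-translate f T ts)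

  -- The interval between the two lists contributes nothing, as f vanishes at the last point of
  -- `ts`. That point is characterised as a maximum, the form in which `atEnd` treats it.
  integrate-++ : ∀ f ts us → AllPairs _≤_ ts → (∀ {t} → t ∈ ts → All (_≤ t) ts → f t ≡ 0ℝ) →
                 integrate f (ts ++ us) ≡ integrate f ts + integrate f us
  integrate-++ f []       us       _  _    = sym (+-identityˡ _)
  integrate-++ f (t ∷ []) []       _  _    = sym (+-identityˡ _)
  integrate-++ f (t ∷ []) (u ∷ us) _  last = cong (_+ integrate f (u ∷ us))
      (trans (cong (_* (u - t)) (last (here refl) (≤-refl ∷ []))) (zeroˡ _))
  integrate-++ f (t ∷ ts@(t′ ∷ _)) us ((t≤t′ ∷ _) ∷ srt) last = trans
    (cong (f t * (t′ - t) +_) (integrate-++ f ts us srt λ { t∈ le@(t′≤ ∷ _) → last (there t∈) (≤-trans t≤t′ t′≤ ∷ le) }))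
    (sym (+-assoc _ _ _))

  integrate-nonNeg : ∀ {f} → (∀ t → 0ℝ ≤ f t) → ∀ {ts} → AllPairs _≤_ ts → 0ℝ ≤ integrate f ts
  integrate-nonNeg 0≤f []                         = ≤-refl
  integrate-nonNeg 0≤f (_ ∷ [])                   = ≤-refl
  integrate-nonNeg 0≤f ((t≤ ∷ _) ∷ srt@(_ ∷ _)) = 0≤+ (*-nonNeg (0≤f _) (≤⇒0≤- t≤)) (integrate-nonNeg 0≤f srt)

  module _ {f : ℝ → ℝ} (0≤f : ∀ t → 0ℝ ≤ f t) {a d} (1≤f : ∀ {t} → a ≤ t → t < d → 1ℝ ≤ f t) where

    -- Intervals starting before d contribute at least their length; from d on, non-negativity is
    -- enough.
    integrate-≥-from : ∀ t ts → AllPairs _≤_ (t ∷ ts) → a ≤ t → d ∈ t ∷ ts → d - t ≤ integrate f (t ∷ ts)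
    integrate-≥-from t ts srt a≤t (here refl) = ≤-trans (≤-reflexive (-‿inverseʳ t)) (integrate-nonNeg 0≤f srt)
    integrate-≥-from t (t′ ∷ ts) srt@((t≤t′ ∷ _) ∷ srt′) a≤t (there d∈) with t <? d
    ... | yes t<d = ≤-trans (≤-reflexive (solve 3 (λ x y d → d :- x := con (1 , 0) :* (y :- x) :+ (d :- y)) refl t t′ d))
                      (+-mono-≤ (*-monoˡ-≤ (≤⇒0≤- t≤t′) (1≤f a≤t t<d)) (integrate-≥-from t′ ts srt′ (≤-trans a≤t t≤t′) d∈))
    ... | no  t≮d = ≤-trans (≤-from (≤⇒0≤- (≮⇒≥ t≮d)) (solve 2 (λ t d → con (0 , 0) := (d :- t) :+ (t :- d)) refl t d))
        (integrate-nonNeg 0≤f srt)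

    integrate-≥ : ∀ {ts} → AllPairs _≤_ ts → a ∈ ts → d ∈ ts → d - a ≤ integrate f ts
    integrate-≥ {t ∷ ts} srt (here refl) d∈ = integrate-≥-from t ts srt ≤-refl d∈
    -- Here d precedes a in the sorted list, so d - a is at most 0.
    integrate-≥ {t ∷ ts} srt@(t≤ ∷ _) (there a∈) (here refl) =
      ≤-trans (≤-from (≤⇒0≤- (All.lookup t≤ a∈)) (solve 2 (λ a d → con (0 , 0) := (d :- a) :+ (a :- d)) refl a d))
          (integrate-nonNeg 0≤f srt)
    integrate-≥ {t ∷ t′ ∷ ts} ((t≤t′ ∷ _) ∷ srt) (there a∈) (there d∈) =
      ≤-trans (integrate-≥ srt a∈ d∈) (≤-from (*-nonNeg (0≤f t) (≤⇒0≤- t≤t′)) (+-comm _ _))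

  times-sorted : ∀ xs → AllPairs _≤_ (map time (eventsOf xs))
  times-sorted xs = AllPairs.map⁺ (eventsOf-chronological xs)

  partitions-nonEmpty : ∀ x xs → All (λ bs → 1 ℕ.≤ length bs) (partitions (x ∷ xs))
  partitions-nonEmpty x xs = All.concat⁺ (All.map⁺ (All.universal (inserted _ refl (λ _ _ → refl)) (partitions xs)))
    where
    -- `insertions` is local to `partitions`, hence given by its defining equations.
    inserted : ∀ (ins : List (List ℝ) → List (List (List ℝ))) → ins [] ≡ [ [ [ x ] ] ] →
               (∀ b bs → ins (b ∷ bs) ≡ ((x ∷ b) ∷ bs) ∷ map (b ∷_) (ins bs)) → ∀ bs → All (λ bs → 1 ℕ.≤ length bs) (ins bs)
    inserted ins nil cons []       = subst (All _) (sym nil) (s≤s z≤n ∷ [])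
    inserted ins nil cons (b ∷ bs) = subst (All _) (sym (cons b bs)) (s≤s z≤n ∷ All.map⁺ (All.universal (λ _ → s≤s z≤n) (ins bs)))

  -- Every candidate packing has a bin, and so does the default of one bin per item.
  1≤minBins : ∀ x xs → 1 ℕ.≤ minBins (x ∷ xs)
  1≤minBins x xs = Extrema.v≤min⁺ (s≤s z≤n) (All.map⁺ (All.filter⁺ (all? (λ b → sum b ≤? 1ℝ)) (partitions-nonEmpty x xs)))

  1≤binsAt : ∀ {xs i t} → i ∈ xs → Present t i → 1ℝ ≤ binsAt xs t
  1≤binsAt {xs} {i} {t} i∈ p = ≤-trans (≤-reflexive (sym (+-identityʳ 1ℝ)))
      (fromℕ-mono (nonEmpty′ (∈-map⁺ size (∈-filter⁺ (present? t) i∈ p))))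
    where
    nonEmpty′ : ∀ {ss} → size i ∈ ss → 1 ℕ.≤ minBins ss
    nonEmpty′ {s ∷ ss} _ = 1≤minBins s ss

  -- The item alone keeps the number of bins at 1 or more during its stay. As durations are at least
  -- 1, this is why OPT grows by at least 1 per phase.
  duration≤optimum : ∀ {xs i} → i ∈ xs → duration i ≤ optimum xs
  duration≤optimum {xs} {i} i∈ = ≤-trans (≤-reflexive (solve 2 (λ a d → d := a :+ d :- a) refl (arrival i) (duration i)))
    (integrate-≥ (λ t → 0≤fromℕ (minBins (sizesAt xs t))) (λ a≤t t<d → 1≤binsAt i∈ (a≤t , t<d))
      (times-sorted xs) (∈-map⁺ time (proj₂ (arrival∈eventsOf i∈))) (∈-map⁺ time (proj₂ (departure∈eventsOf i∈))))

  module _ {T} (0≤T : 0ℝ ≤ T) (xs ys : List Item) (xs<T : All (λ i → departure i < T) xs) where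
    private
      ys′ = map (delay 0≤T) ys

      sizesAt-++ : ∀ t → sizesAt (xs ++ ys′) t ≡ sizesAt xs t ++ sizesAt ys′ t
      sizesAt-++ t = trans (cong (map size) (List.filter-++ (present? t) xs ys′)) (List.map-++ size (filter (present? t) xs) _)

      sizesAt-none : ∀ {t} zs → All (λ i → ¬ Present t i) zs → sizesAt zs t ≡ []
      sizesAt-none {t} zs none = cong (map size) (List.filter-none (present? t) none)

      early : ∀ {t} → t < T → sizesAt (xs ++ ys′) t ≡ sizesAt xs t
      early {t} t<T = trans (sizesAt-++ t) (trans (cong (sizesAt xs t ++_)
        (sizesAt-none ys′ (All.map⁺ (All.universal (λ i (a≤t , _) → <⇒≱ t<T (≤-trans (x≤x+y (arrival≥0 i)) a≤t)) ys))))
            (List.++-identityʳ _))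

      delayed : ∀ t zs → sizesAt (map (delay 0≤T) zs) (T + t) ≡ sizesAt zs t
      delayed t []       = refl
      delayed t (i ∷ zs) with present? t i
      ... | yes p = trans (cong (map size) (List.filter-accept (present? (T + t)) {xs = map (delay 0≤T) zs} (there′ p)))
                      (trans (cong (size i ∷_) (delayed t zs))
                          (cong (map size) (sym (List.filter-accept (present? t) {xs = zs} p))))
        where
        there′ : Present t i → Present (T + t) (delay 0≤T i)
        there′ (a≤t , t<d) = +-monoʳ-≤ T a≤t , ≰⇒> λ le → <⇒≱ t<d (+-cancelˡ-≤ T (subst (_≤ T + t) (+-assoc T _ _) le))
      ... | no ¬p = trans (cong (map size) (List.filter-reject (present? (T + t)) {xs = map (delay 0≤T) zs} (¬p ∘ back)))
                      (trans (delayed t zs) (cong (map size) (sym (List.filter-reject (present? t) {xs = zs} ¬p))))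
        where
        back : Present (T + t) (delay 0≤T i) → Present t i
        back (a≤t , t<d) = +-cancelˡ-≤ T a≤t , ≰⇒> λ le → <⇒≱ t<d (subst (_≤ T + t) (sym (+-assoc T _ _)) (+-monoʳ-≤ T le))

      late : ∀ {t} → 0ℝ ≤ t → sizesAt (xs ++ ys′) (T + t) ≡ sizesAt ys t
      late {t} 0≤t = trans (sizesAt-++ (T + t)) (trans (cong (_++ sizesAt ys′ (T + t))
        (sizesAt-none xs (All.map (λ d<T (_ , t<d) → <⇒≱ (<-≤-trans d<T (x≤x+y 0≤t)) (proj₁ t<d)) xs<T))) (delayed t ys))

      times<T : All (_< T) (map time (eventsOf xs))
      times<T = All.map⁺ (All-eventsOf (λ _ p → p) (λ _ {i} p → ≤-<-trans (arrival≤departure i) p) xs<T)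

      times≥0 : All (0ℝ ≤_) (map time (eventsOf ys))
      times≥0 = All.map⁺ (All-eventsOf {Q = λ _ → ⊤} (λ _ {i} _ → ≤-trans (arrival≥0 i) (arrival≤departure i))
          (λ _ {i} _ → arrival≥0 i) (All.universal (λ _ → tt) ys))

      -- At the latest event time every departure has been reached, and an item is absent from the
      -- moment of its departure.
      atEnd : ∀ {t} → t ∈ map time (eventsOf xs) → All (_≤ t) (map time (eventsOf xs)) → binsAt (xs ++ ys′) t ≡ 0ℝ
      atEnd {t} t∈ ≤t = cong (fromℕ ∘ minBins) (trans (early (All.lookup times<T t∈))
        (sizesAt-none xs (All.tabulate λ i∈ (_ , t<d) → <⇒≱ t<d (All.lookup ≤t (∈-map⁺ time (proj₂ (departure∈eventsOf i∈)))))))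

    optimum-++ : optimum (xs ++ ys′) ≡ optimum xs + optimum ys
    optimum-++ = begin
      integrate F (map time (eventsOf (xs ++ ys′)))
        ≡⟨ cong (integrate F ∘ map time) (eventsOf-++ 0≤T xs ys xs<T) ⟩
      integrate F (map time (eventsOf xs ++ map sh (eventsOf ys)))
        ≡⟨ cong (integrate F) (trans (List.map-++ time (eventsOf xs) _) (cong (map time (eventsOf xs) ++_) shifted)) ⟩
      integrate F (map time (eventsOf xs) ++ map (T +_) (map time (eventsOf ys)))
        ≡⟨ integrate-++ F (map time (eventsOf xs)) _ (times-sorted xs) atEnd ⟩
      integrate F (map time (eventsOf xs)) + integrate F (map (T +_) (map time (eventsOf ys)))
        ≡⟨ cong₂ _+_ (integrate-cong (All.map (cong (fromℕ ∘ minBins) ∘ early) times<T))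
                     (trans (integrate-translate F T (map time (eventsOf ys)))
                         (integrate-cong (All.map (cong (fromℕ ∘ minBins) ∘ late) times≥0))) ⟩
      optimum xs + optimum ys ∎
      where
      open ≡-Reasoning
      F  = binsAt (xs ++ ys′)
      sh = shift (length xs) T
      shifted : map time (map sh (eventsOf ys)) ≡ map (T +_) (map time (eventsOf ys))
      shifted = trans (sym (List.map-∘ (eventsOf ys))) (trans (List.map-cong (time-shift (length xs) T) (eventsOf ys))
          (List.map-∘ (eventsOf ys)))

-- Cost and migrations of `A`, phase by phase

module Phases (em : ExcludedMiddle 0ℓ) (R : Reals) (A : DynamicBinPacking.RandomizedAlgorithm R) where
  open DynamicBinPacking R
  open RealProperties R
  open Solver using (solve; _:=_; _:+_; _:*_; _:-_; con)
  open Events R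
  open Traces R
  open Imitation R
  open Optimum R
  open RandomizedAlgorithm A
  open Integration em R space
  open Measurability em R A

  -- Makes the bins of the imitation random variables: they depend on finitely many placements of
  -- `A`, each with values in ℕ.
  simulate-measurable : ∀ h c es (Q : Config → Set) → Measurable (λ ω → Q (simulate (policy ω) h c es))
  simulate-measurable h c []       Q = measurable-const _
  simulate-measurable h c (e ∷ es) Q = measurable-bind countable-ℕ (place-measurable (h ++ [ e ]))
    λ b → simulate-measurable (h ++ [ e ]) (update (action e) b c) es Q

  eventsOf-valid : ∀ xs → All ValidSize (eventsOf xs)
  eventsOf-valid xs = All-eventsOf {Q = λ _ → ⊤} (λ _ _ → tt) (λ _ {i} _ → size≥0 i , size≤1 i) (All.universal (λ _ → tt) xs)

  imitator : History → ℕ → ℝ → RandomizedAlgorithm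
  imitator H N T = record
    { space              = space
    ; policy             = λ ω → stationary (imitate (policy ω) H N T)
    ; feasible           = λ ω I → imitate-feasible (policy ω) H N T (events I) refl (eventsOf-valid (items I)) [] (λ _ → 0≤1)
    ; place-measurable   = λ h b → simulate-measurable H [] (map (shift N T) h) (λ c → lastBin c ≡ b)
    ; migrate-measurable = λ _ _ → measurable-const _
    ; later-measurable   = λ _ _ → measurable-const _
    ; delay-measurable   = λ _ _ → measurable-const _
    }

  imitator-migrationFree : ∀ H N T → MigrationFree (imitator H N T)
  imitator-migrationFree H N T ω I = stationary-moved (imitate (policy ω) H N T) [] [] (events I)

  horizon : ∀ xs → ∃[ T ] 0ℝ ≤ T × All (λ i → departure i < T) xs
  horizon []       = 0ℝ , ≤-refl , []
  horizon (i ∷ xs) =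
    let T , 0≤T , xs<T = horizon xs
        d≥0            = ≤-trans (arrival≥0 i) (arrival≤departure i)
        T<             = x<1+x (departure i + T)
    in 1ℝ + (departure i + T)
     , 0≤+ 0≤1 (0≤+ d≥0 0≤T)
     , ≤-<-trans (x≤x+y 0≤T) T< ∷ All.map (λ d<T → <-≤-trans d<T (≤-trans (≤-from d≥0 (+-comm _ _)) (proj₁ T<))) xs<T

  -- Bounds of at least 1 make the constants C and m positive, so that their product can be
  -- inverted.
  upperBound : ∀ (f : Instance → ℝ) Is → ∃[ C ] 1ℝ ≤ C × All (λ I → f I ≤ C) Is
  upperBound f []       = 1ℝ , ≤-refl , []
  upperBound f (I ∷ Is) with upperBound f Is
  ... | C , 1≤C , ≤C with total (f I) C
  ...   | inj₁ I≤C = C , 1≤C , I≤C ∷ ≤C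
  ...   | inj₂ C≤I = f I , ≤-trans 1≤C C≤I , ≤-refl ∷ All.map (λ le → ≤-trans le C≤I) ≤C

  costBound : Instance → ℝ
  costBound I = fromℕ (length (events I)) * span (events I)

  -- On item lists instead of instances, so that the phases can start from the empty list.
  costOf : List Item → Ω → ℝ
  costOf xs ω = totalCost (trace (policy ω) [] [] (eventsOf xs))

  movedOf : List Item → Ω → ℕ
  movedOf xs ω = totalMoved (trace (policy ω) [] [] (eventsOf xs))

  costOf≥0 : ∀ zs ω → 0ℝ ≤ costOf zs ω
  costOf≥0 zs ω = 0≤totalCost (trace-elapsed (policy ω) [] [] (eventsOf zs) (eventsOf-chronological zs))

  module _ (xs : List Item) {T} (0≤T : 0ℝ ≤ T) (xs<T : All (λ i → departure i < T) xs) (I : Instance)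
           (xs-sorted : AllPairs (λ i j → arrival i ≤ arrival j) xs) where

    private
      H  = eventsOf xs
      N  = length xs
      sh = shift N T

    appended : List Item
    appended = xs ++ map (delay 0≤T) (items I)

    appended-sorted : AllPairs (λ i j → arrival i ≤ arrival j) appended
    appended-sorted = AllPairs.++⁺ xs-sorted
      (AllPairs.map⁺ (AllPairs.map (+-monoʳ-≤ T) (Linked⇒AllPairs ≤-trans (sorted I))))
      (All.map (λ {i} d<T → All.map⁺ (All.universal (λ j → ≤-trans (≤-trans (arrival≤departure i) (proj₁ d<T))
          (x≤x+y (arrival≥0 j))) (items I))) xs<T)

    appendedInstance : Instance
    appendedInstance = record
      { items    = appended
      ; nonEmpty = λ eq → nonEmpty I (map≡[] (items I) (List.++-conicalʳ xs _ eq))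
      ; sorted   = AllPairs⇒Linked appended-sorted
      }
      where
      map≡[] : ∀ zs → map (delay 0≤T) zs ≡ [] → zs ≡ []
      map≡[] [] _ = refl

    phase : Ω → List Period
    phase ω = trace (policy ω) H [] (map sh (events I))

    trace-appended : ∀ ω → ∃[ gap ] trace (policy ω) [] [] (eventsOf appended) ≡ trace (policy ω) [] [] H ++ gap ++ phase ω
    trace-appended ω =
      let gap , eq = trace-++ (policy ω) [] [] H (map sh (events I)) (eventsOf-chronological xs) (eventsOf-closed xs) []
      in gap , trans (cong (trace (policy ω) [] []) (eventsOf-++ 0≤T xs (items I) xs<T)) eq

    Disturbed : Ω → Set
    Disturbed ω = totalMoved (phase ω) ≢ 0

    disturbed-measurable : Measurable Disturbed
    disturbed-measurable = traceMoved-measurable H [] (map sh (events I)) (_≢ 0)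

    private
      rest≥0 : ∀ ω → All (λ p → 0ℝ ≤ elapsed p) (proj₁ (trace-appended ω) ++ phase ω)
      rest≥0 ω = All.++⁻ʳ (trace (policy ω) [] [] H)
        (subst (All _) (proj₂ (trace-appended ω)) (trace-elapsed (policy ω) [] [] (eventsOf appended)
            (eventsOf-chronological appended)))

      costOf-appended : ∀ ω → costOf appended ω ≡ costOf xs ω + (totalCost (proj₁ (trace-appended ω)) + totalCost (phase ω))
      costOf-appended ω = trans (cong totalCost (proj₂ (trace-appended ω)))
        (trans (totalCost-++ (trace (policy ω) [] [] H) _) (cong (costOf xs ω +_)
            (totalCost-++ (proj₁ (trace-appended ω)) (phase ω))))

      movedOf-appended : ∀ ω → movedOf appended ω ≡ movedOf xs ω ℕ.+
          (totalMoved (proj₁ (trace-appended ω)) ℕ.+ totalMoved (phase ω))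
      movedOf-appended ω = trans (cong totalMoved (proj₂ (trace-appended ω)))
        (trans (totalMoved-++ (trace (policy ω) [] [] H) _) (cong (movedOf xs ω ℕ.+_)
            (totalMoved-++ (proj₁ (trace-appended ω)) (phase ω))))

      gap≥0 : ∀ ω → 0ℝ ≤ totalCost (proj₁ (trace-appended ω))
      gap≥0 ω = 0≤totalCost (All.++⁻ˡ (proj₁ (trace-appended ω)) (rest≥0 ω))

      phase≥0 : ∀ ω → 0ℝ ≤ totalCost (phase ω)
      phase≥0 ω = 0≤totalCost (All.++⁻ʳ (proj₁ (trace-appended ω)) (rest≥0 ω))

      phase-feasible : ∀ ω → All (Feasible ∘ config) (phase ω)
      phase-feasible ω = All.++⁻ʳ (proj₁ (trace-appended ω)) (All.++⁻ʳ (trace (policy ω) [] [] H)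
        (subst (All _) (proj₂ (trace-appended ω)) (feasible ω appendedInstance)))

      imitationCost : Ω → ℝ
      imitationCost ω = cost (stationary (imitate (policy ω) H N T)) I

      phase-cost : ∀ ω → ¬ Disturbed ω → totalCost (phase ω) ≡ imitationCost ω
      phase-cost ω calm = trans (cong (λ h → totalCost (trace (policy ω) h [] (map sh (events I)))) (sym H≡))
        (imitate-cost (policy ω) H N T (events I) refl
          (subst (λ h → All (Feasible ∘ config) (trace (policy ω) h [] (map sh (events I)))) (sym H≡) (phase-feasible ω))
          (trans (cong (λ h → totalMoved (trace (policy ω) h [] (map sh (events I)))) H≡)
              (decidable-stable (totalMoved (phase ω) ℕ.≟ 0) calm)))
        where
        H≡ : H ++ [] ≡ H
        H≡ = List.++-identityʳ H

    -- Superadditivity for the past cost and the cost of the imitation. The new events never lower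
    -- the past cost; outside `Disturbed` the phase adds exactly the cost of the imitation, and the
    -- gap at least 0.
    costOf-appended-≥ : ∀ {C c₁ c₂} → 0ℝ ≤ C → costBound I ≤ C → 𝔼[ costOf xs ]≥ c₁ → 𝔼cost[ imitator H N T , I ]≥ c₂ →
                        𝔼[ costOf appended ]≥ (c₁ + c₂ - C * ℙ Disturbed disturbed-measurable)
    costOf-appended-≥ {C} 0≤C bound≤C = 𝔼≥-superadditive disturbed-measurable 0≤C (costOf≥0 xs)
      (λ ω → 0≤totalCost (trace-elapsed _ [] [] (events I) (eventsOf-chronological (items I))))
      (λ ω → ≤-trans (stationary-cost-≤ (imitate (policy ω) H N T) [] [] (events I) (length (events I))
          (eventsOf-chronological (items I)) ℕ.≤-refl) bound≤C)
      (λ ω → ≤-from (0≤+ (gap≥0 ω) (phase≥0 ω)) (costOf-appended ω))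
      (λ ω calm → ≤-from (gap≥0 ω) (trans (costOf-appended ω)
          (trans (cong (λ x → costOf xs ω + (totalCost (proj₁ (trace-appended ω)) + x)) (phase-cost ω calm))
        (solve 3 (λ x y z → x :+ (y :+ z) := x :+ z :+ y) refl (costOf xs ω) _ _))))

    -- A disturbed phase has at least one migration. The decision is arbitrary, to fit the summand
    -- in `eval`.
    movedOf-appended-≥ : ∀ ω → (d? : Dec (Disturbed ω)) → weigh 1ℝ d? + fromℕ (movedOf xs ω) ≤ fromℕ (movedOf appended ω)
    movedOf-appended-≥ ω (yes moved≢0) = fromℕ-mono (subst (suc (movedOf xs ω) ℕ.≤_) (sym (movedOf-appended ω))
      (subst (ℕ._≤ movedOf xs ω ℕ.+ (totalMoved (proj₁ (trace-appended ω)) ℕ.+ totalMoved (phase ω))) (ℕ.+-comm (movedOf xs ω) 1)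
        (ℕ.+-monoʳ-≤ (movedOf xs ω) (ℕ.≤-trans (ℕ.n≢0⇒n>0 moved≢0) (ℕ.m≤n+m _ (totalMoved (proj₁ (trace-appended ω))))))))
    movedOf-appended-≥ ω (no _) = ≤-trans (≤-reflexive (+-identityˡ _))
        (fromℕ-mono (subst (movedOf xs ω ℕ.≤_) (sym (movedOf-appended ω)) (ℕ.m≤m+n _ _)))

  module _ {μ β : ℝ} (𝓘′ : List Instance) (𝓘′⊆ : All (𝓘 μ) 𝓘′)
           (hard : (A′ : RandomizedAlgorithm) → MigrationFree A′ → Any (λ I → 𝔼cost[ A′ , I ]≥ (β * OPT I)) 𝓘′)
           {C m : ℝ} (0≤C : 0ℝ ≤ C) (cost≤C : All (λ I → costBound I ≤ C) 𝓘′) (size≤m : All (λ I → fromℕ ∣ I ∣ ≤ m) 𝓘′) where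

    -- The lower bound on the length lets the instance pass the threshold of sublinearity; the upper
    -- bound turns a bound in the number of items into one in K, hence in OPT. The events of
    -- disturbance form one combination, so that the sum of their probabilities is the mean of a
    -- function below the number of migrations.
    record Stage (K : ℕ) : Set₁ where
      field
        jobs      : List Item
        ordered   : AllPairs (λ i j → arrival i ≤ arrival j) jobs
        durations : All (λ i → 1ℝ ≤ duration i × duration i ≤ μ) jobs
        K≤length  : K ℕ.≤ length jobs
        length≤   : fromℕ (length jobs) ≤ fromℕ K * m
        K≤optimum : fromℕ K ≤ optimum jobs
        disturbed : Combination
        weights≥0 : All (λ t → 0ℝ ≤ proj₁ t) disturbed
        eval≤     : ∀ ω → eval disturbed ω ≤ fromℕ (movedOf jobs ω)
        cost≥     : 𝔼[ costOf jobs ]≥ (β * optimum jobs - C * 𝔼 disturbed)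

    initial : Stage 0
    initial = record
      { jobs      = []
      ; ordered   = []
      ; durations = []
      ; K≤length  = z≤n
      ; length≤   = ≤-reflexive (sym (zeroˡ m))
      ; K≤optimum = ≤-refl
      ; disturbed = []
      ; weights≥0 = []
      ; eval≤     = λ _ → ≤-refl
      -- The empty simple function, of mean 0, shows that every upper bound u is non-negative.
      ; cost≥     = λ u le → ≤-trans (≤-reflexive (solve 2 (λ b c → b :* con (0 , 0) :- c :* con (0 , 0) := con
          (0 , 0)) refl β C))
                                      (le (record { pieces = [] ; disjoint = [] }) [])
      }

    extend : ∀ {K} → Stage K → Stage (suc K)
    extend {K} S = record
      { jobs      = appended xs 0≤T xs<T I ordered
      ; ordered   = appended-sorted xs 0≤T xs<T I ordered
      ; durations = All.++⁺ durations (All.map⁺ I∈𝓘)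
      ; K≤length  = ℕ.≤-trans (ℕ.≤-reflexive (ℕ.+-comm 1 K))
          (subst (K ℕ.+ 1 ℕ.≤_) (sym length≡) (ℕ.+-mono-≤ K≤length (1≤length (items I) (nonEmpty I))))
      ; length≤   = ≤-trans (≤-reflexive (trans (cong fromℕ length≡) (fromℕ-+ (length xs) _)))
                      (≤-trans (+-mono-≤ length≤ (All.lookup size≤m I∈))
                          (≤-reflexive (solve 2 (λ k m → k :* m :+ m := (con (1 , 0) :+ k) :* m) refl (fromℕ K) m)))
      ; K≤optimum = ≤-trans (≤-reflexive (+-comm 1ℝ (fromℕ K)))
          (subst (fromℕ K + 1ℝ ≤_) (sym optimum≡) (+-mono-≤ K≤optimum (1≤optimum (items I) (nonEmpty I) I∈𝓘)))
      ; disturbed = (1ℝ , Disturbed xs 0≤T xs<T I ordered , measurable-B) ∷ disturbed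
      ; weights≥0 = 0≤1 ∷ weights≥0
      ; eval≤     = λ ω → ≤-trans (+-monoʳ-≤ _ (eval≤ ω)) (movedOf-appended-≥ xs 0≤T xs<T I ordered ω em)
      ; cost≥     = subst (𝔼[ costOf (appended xs 0≤T xs<T I ordered) ]≥_)
          (trans (solve 6 (λ b o o′ c e p → (b :* o :- c :* e) :+ b :* o′ :- c :* p := b :* (o :+ o′) :- c :*
              (con (1 , 0) :* p :+ e)) refl
                   β (optimum xs) (OPT I) C (𝔼 disturbed) (ℙ _ measurable-B))
                 (cong (λ o → β * o - C * (1ℝ * ℙ _ measurable-B + 𝔼 disturbed)) (sym optimum≡)))
          (costOf-appended-≥ xs 0≤T xs<T I ordered 0≤C (All.lookup cost≤C I∈) cost≥ (proj₂ (proj₂ chosen)))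
      }
      where
      open Stage S renaming (jobs to xs)
      T    = proj₁ (horizon xs)
      0≤T  = proj₁ (proj₂ (horizon xs))
      xs<T = proj₂ (proj₂ (horizon xs))

      chosen : ∃[ I ] I ∈ 𝓘′ × 𝔼cost[ imitator (eventsOf xs) (length xs) T , I ]≥ (β * OPT I)
      chosen = find (hard (imitator (eventsOf xs) (length xs) T) (imitator-migrationFree (eventsOf xs) (length xs) T))

      I   = proj₁ chosen
      I∈  = proj₁ (proj₂ chosen)
      I∈𝓘 = All.lookup 𝓘′⊆ I∈
      measurable-B = disturbed-measurable xs 0≤T xs<T I ordered

      length≡ : length (xs ++ map (delay 0≤T) (items I)) ≡ length xs ℕ.+ ∣ I ∣
      length≡ = trans (List.length-++ xs) (cong (length xs ℕ.+_) (List.length-map (delay 0≤T) (items I)))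

      optimum≡ : optimum (xs ++ map (delay 0≤T) (items I)) ≡ optimum xs + OPT I
      optimum≡ = optimum-++ 0≤T xs (items I) xs<T

      1≤length : ∀ (zs : List Item) → zs ≢ [] → 1 ℕ.≤ length zs
      1≤length []      ≢[] = contradiction refl ≢[]
      1≤length (_ ∷ _) _   = s≤s z≤n

      1≤optimum : ∀ zs → zs ≢ [] → All (λ i → 1ℝ ≤ duration i × duration i ≤ μ) zs → 1ℝ ≤ optimum zs
      1≤optimum []       ≢[] _             = contradiction refl ≢[]
      1≤optimum (z ∷ zs) _   ((1≤d , _) ∷ _) = ≤-trans 1≤d (duration≤optimum {z ∷ zs} {z} (here refl))

    stage : ∀ K → Stage K
    stage zero    = initial
    stage (suc K) = extend (stage K)

-- Choice of the constants and conclusion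

theorem6 : ExcludedMiddle 0ℓ →
    (R : Reals) → let open DynamicBinPacking R in
    (μ β : ℝ) → 1ℝ < μ → 0ℝ < β →
    (𝓘′ : List Instance) → All (𝓘 μ) 𝓘′ →
    ((A : RandomizedAlgorithm) → MigrationFree A →
    Any (λ I → 𝔼cost[ A , I ]≥ (β * OPT I)) 𝓘′) →
    (A : RandomizedAlgorithm) → SublinearMigrations μ A →
    ∃[ I ] 𝓘 μ I × 𝔼cost[ A , I ]≥ (β / fromℕ 3 * OPT I)
theorem6 em R μ β _ 0<β 𝓘′ 𝓘′⊆ hard A sublinear = J , durations , bound
  where
  open DynamicBinPacking R
  open RealProperties R
  open Solver using (solve; _:=_; _:+_; _:*_; _:-_; con)
  open Optimum R
  open RandomizedAlgorithm A
  open Integration em R space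
  open Phases em R A

  C      = proj₁ (upperBound costBound 𝓘′)
  0<C    = <-≤-trans 0<1 (proj₁ (proj₂ (upperBound costBound 𝓘′)))
  cost≤C = proj₂ (proj₂ (upperBound costBound 𝓘′))
  m      = proj₁ (upperBound (fromℕ ∘ ∣_∣) 𝓘′)
  0<m    = <-≤-trans 0<1 (proj₁ (proj₂ (upperBound (fromℕ ∘ ∣_∣) 𝓘′)))
  size≤m = proj₂ (proj₂ (upperBound (fromℕ ∘ ∣_∣) 𝓘′))

  q = β / fromℕ 3

  0<q : 0ℝ < q
  0<q = 0<* 0<β (0<⁻¹ (0<fromℕ-suc 2))

  β≡3q : β ≡ fromℕ 3 * q
  β≡3q = trans (sym (*-identityˡ β)) (trans (cong (_* β) (sym (*-inverseʳ (fromℕ 3) (proj₂ (0<fromℕ-suc 2) ∘ sym))))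
           (solve 3 (λ x y z → x :* y :* z := x :* (z :* y)) refl (fromℕ 3) (fromℕ 3 ⁻¹) β))

  -- Then the migrations of K phases cost at most C ε K m = q K, which is at most a third of β · OPT.
  ε = q * (C * m) ⁻¹

  0<ε : 0ℝ < ε
  0<ε = 0<* 0<q (0<⁻¹ (0<* 0<C 0<m))

  Cεm≡q : C * (ε * m) ≡ q
  Cεm≡q = trans (solve 4 (λ c q i m → c :* (q :* i :* m) := q :* (i :* (c :* m))) refl C q ((C * m) ⁻¹) m)
    (trans (cong (q *_) (*-inverseˡ (0<* 0<C 0<m))) (*-identityʳ q))

  N = proj₁ (sublinear ε 0<ε)
  -- Enough items to reach the threshold N, and at least one phase, so that the instance is
  -- nonempty.
  K = suc N

  open Stage (stage 𝓘′ 𝓘′⊆ hard (proj₁ 0<C) cost≤C size≤m K)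

  jobs≢[] : ∀ {zs : List Item} → K ℕ.≤ length zs → zs ≢ []
  jobs≢[] () refl

  J : Instance
  J = record { items = jobs ; nonEmpty = jobs≢[] K≤length ; sorted = AllPairs⇒Linked ordered }

  -- The number of disturbed phases is at most that of migrations, whose expectation is at most ε
  -- times the number of items; there are at most K m items, and K is at most OPT.
  𝔼disturbed≤ : 𝔼 disturbed ≤ ε * m * optimum jobs
  𝔼disturbed≤ = ≤-trans
    (𝔼≤-combination (proj₂ (sublinear ε 0<ε) (length jobs) (ℕ.≤-trans
        (ℕ.n≤1+n N) K≤length) J durations refl) disturbed weights≥0 eval≤)
    (≤-trans (*-monoʳ-≤ (proj₁ 0<ε) (≤-trans length≤ (*-monoˡ-≤ (proj₁ 0<m) K≤optimum)))
      (≤-reflexive (solve 3 (λ e o m → e :* (o :* m) := e :* m :* o) refl ε (optimum jobs) m)))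

  bound : 𝔼cost[ A , J ]≥ (q * OPT J)
  -- β OPT consists of three shares q OPT: one is the claim, one pays for the disturbed phases since
  -- C ε m = q, and the third is dropped as non-negative.
  bound u le = ≤-trans (≤-from (0≤+ (*-nonNeg (proj₁ 0<C) (≤⇒0≤- 𝔼disturbed≤)) (*-nonNeg (proj₁ 0<q) 0≤optimum))
    (trans (cong (λ b → b * optimum jobs - C * 𝔼 disturbed) β≡3q)
      (trans (solve 5 (λ q o c d x → (con (1 , 0) :+ (con (1 , 0) :+ (con (1 , 0) :+ con (0 , 0)))) :* q :* o :- c :* d
                 := q :* o :+ (c :* (x :* o :- d) :+ q :* o) :+ (q :- c :* x) :* o) refl q (optimum jobs) C (𝔼 disturbed) (ε * m))
        (trans (cong (λ x → rhs + (q - x) * optimum jobs) Cεm≡q)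
            (solve 3 (λ r q o → r :+ (q :- q) :* o := r) refl rhs q (optimum jobs))))))
    (cost≥ u le)
    where
    rhs = q * optimum jobs + (C * (ε * m * optimum jobs - 𝔼 disturbed) + q * optimum jobs)
    0≤optimum : 0ℝ ≤ optimum jobs
    0≤optimum = ≤-trans (0≤fromℕ K) K≤optimum
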